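{- Let $r\ge4$, $n\ge2r$, $2\le s\le r$, and let $X$ be one of $\{r+2\}$, $\{4,r+2\}$, $\{2,4,r+2\}$, or $\{2,3,\dots,t,r+2\}$, where $t=|X|$ (so $t\ge4$ in the last case). Let $\mathcal{A}_{n,r,s}=F(r,n,\{[s,2s-1]\})$. If $t=2$, $s=2$: $|\mathcal{A}_{n,r,2}(X)|=2\binom{n-3}{r-3}-\binom{n-4}{r-4}+2\left(2\binom{n-4}{r-3}-\binom{n-5}{r-4}\right)$. If $t=2$, $s=3$: $|\mathcal{A}_{n,r,3}(X)|=2\binom{n-4}{r-4}-\binom{n-5}{r-5}+3\binom{n-4}{r-3}+3\binom{n-6}{r-4}+3\binom{n-5}{r-3}$. If $t=3$, $s=2$: $|\mathcal{A}_{n,r,2}(X)|=\binom{n-2}{r-2}+\binom{n-3}{r-2}+2\binom{n-4}{r-3}-\binom{n-5}{r-4}$. If $t=3$, $s=3$: $|\mathcal{A}_{n,r,3}(X)|=\binom{n-3}{r-3}+3\binom{n-4}{r-3}+5\binom{n-5}{r-3}+\binom{n-6}{r-4}$. Otherwise, $$|\mathcal{A}_{n,r,s}(X)|=\sum_{i=s}^{2s-1}\left(\binom{i-1}{s-1}-\binom{i-t}{s-1}\right)\binom{n-i}{r-s}+\sum_{i=s}^{\min\{r+1,2s-1\}}\binom{i-t}{s-1}\binom{n-i-1}{r-s-1}+E,$$ where $E=\binom{r+2-t}{s-1}\binom{n-r-2}{r-s}+\sum_{i=r+3}^{2s-1}\binom{i-t-1}{s-2}\binom{n-i}{r-s}$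 if $2s-1\ge r+2$ and $E=0$ otherwise.
   Context: $[a,b]=\{a,\dots,b\}$, $[n]=[1,n]$; $\binom{[n]}{r}$ is the set of $r$-subsets of $[n]$ listed increasingly. For $A=\{a_1<\dots<a_r\}$ and $C=\{c_1<\dots<c_k\}$, $A\prec C$ means $r\ge k$ and $a_i\le c_i$ for $1\le i\le k$. For $\mathcal{G}\subseteq2^{[n]}$, $F(r,n,\mathcal{G})=\{A\in\binom{[n]}{r}:A\prec G\text{ for some }G\in\mathcal{G}\}$. For a family $\mathcal{A}$, $\mathcal{A}(X)=\{A\in\mathcal{A}:A\cap X\ne\emptyset\}$. Convention: for integers $m,k$, $\binom{m}{k}=0$ if $k<0$ or $m<k$. -}

module Defs where

open import Data.Bool using (Bool; true; false; if_then_else_)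
open import Data.Nat as ℕ using (ℕ; zero; suc; _≤_; _∸_; _⊓_; _≤?_; _≟_)
open import Data.Nat.Combinatorics using (_C_)
open import Data.Integer as ℤ using (ℤ; +_; -[1+_]; _⊖_; 0ℤ)
open import Data.List using (List; []; _∷_; map; _++_; upTo; filter; length; foldr)
open import Data.List.Relation.Unary.Any using (Any; any?)
open import Data.List.Membership.DecPropositional _≟_ using (_∈_; _∈?_)
open import Data.Product using (_×_; _,_)
open import Data.Unit using (⊤; tt)
open import Data.Empty using (⊥)
open import Relation.Nullary using (Dec; yes; no; _×-dec_)
open import Relation.Nullary.Decidable using (⌊_⌋)

-- [a,b] = {a,...,b} as an increasing list (empty if b < a)
interval : ℕ → ℕ → List ℕ
interval a b = map (ℕ._+_ a) (upTo (suc b ∸ a))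

[_] : ℕ → List ℕ
[ n ] = interval 1 n

-- all r-element sublists of a list (order preserved); applied to the
-- increasing list [n] this enumerates binom([n], r), each set listed increasingly
choose : List ℕ → ℕ → List (List ℕ)
choose xs zero = [] ∷ []
choose [] (suc r) = []
choose (x ∷ xs) (suc r) = map (x ∷_) (choose xs r) ++ choose xs (suc r)

_≺_ : List ℕ → List ℕ → Set
[] ≺ [] = ⊤
[] ≺ (c ∷ cs) = ⊥
(a ∷ as) ≺ [] = ⊤
(a ∷ as) ≺ (c ∷ cs) = (a ≤ c) × (as ≺ cs)

_≺?_ : (A C : List ℕ) → Dec (A ≺ C)
[] ≺? [] = yes tt
[] ≺? (c ∷ cs) = no (λ ())
(a ∷ as) ≺? [] = yes tt
(a ∷ as) ≺? (c ∷ cs) = (a ≤? c) ×-dec (as ≺? cs)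

F : ℕ → ℕ → List ℕ → List (List ℕ)
F r n G = filter (_≺? G) (choose [ n ] r)

𝒜 : ℕ → ℕ → ℕ → List (List ℕ)
𝒜 n r s = F r n (interval s (2 ℕ.* s ∸ 1))

meets : List (List ℕ) → List ℕ → List (List ℕ)
meets 𝓐 X = filter (λ A → any? (_∈? X) A) 𝓐

Xset : ℕ → ℕ → List ℕ
Xset r 1 = ℕ._+_ r 2 ∷ []
Xset r 2 = 4 ∷ ℕ._+_ r 2 ∷ []
Xset r 3 = 2 ∷ 4 ∷ ℕ._+_ r 2 ∷ []
Xset r t = interval 2 t ++ (ℕ._+_ r 2 ∷ [])

-- admissible values of t: 1, 2, 3, or 4 ≤ t ≤ r+1
-- (t ≤ r+1 is forced by |{2,...,t,r+2}| = t)
data ValidT (r : ℕ) : ℕ → Set where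
  t1 : ValidT r 1
  t2 : ValidT r 2
  t3 : ValidT r 3
  t≥4 : ∀ {t} → 4 ≤ t → t ≤ suc r → ValidT r t

-- binomial coefficient with integer arguments; 0 if k < 0 or m < k
B : ℤ → ℤ → ℤ
B (+ m) (+ k) = + (m C k)
B (+ m) -[1+ k ] = 0ℤ
B -[1+ m ] k = 0ℤ

Σ[_⋯_] : ℕ → ℕ → (ℕ → ℤ) → ℤ
Σ[ a ⋯ b ] f = foldr ℤ._+_ 0ℤ (map f (interval a b))

general : ℕ → ℕ → ℕ → ℕ → ℤ
general r n s t =
  ℤ._+_ (ℤ._+_
    (Σ[ s ⋯ 2 ℕ.* s ∸ 1 ] (λ i →
       ℤ._*_ (ℤ._-_ (B (i ⊖ 1) (s ⊖ 1)) (B (i ⊖ t) (s ⊖ 1))) (B (n ⊖ i) (r ⊖ s))))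
    (Σ[ s ⋯ (suc r ⊓ (2 ℕ.* s ∸ 1)) ] (λ i →
       ℤ._*_ (B (i ⊖ t) (s ⊖ 1)) (B (n ⊖ suc i) (r ⊖ suc s)))))
    E
  where
  E : ℤ
  E = if ⌊ ℕ._+_ r 2 ≤? 2 ℕ.* s ∸ 1 ⌋
      then ℤ._+_ (ℤ._*_ (B ((ℕ._+_ r 2) ⊖ t) (s ⊖ 1)) (B (n ⊖ ℕ._+_ r 2) (r ⊖ s)))
                 (Σ[ ℕ._+_ r 3 ⋯ 2 ℕ.* s ∸ 1 ] (λ i →
                    ℤ._*_ (B (i ⊖ suc t) (s ⊖ 2)) (B (n ⊖ i) (r ⊖ s))))
      else 0ℤ

count : ℕ → ℕ → ℕ → ℕ → ℤ
count r n 2 2 = ℤ._+_ (ℤ._-_ (ℤ._*_ (+ 2) (B (n ⊖ 3) (r ⊖ 3))) (B (n ⊖ 4) (r ⊖ 4)))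
                 (ℤ._*_ (+ 2) (ℤ._-_ (ℤ._*_ (+ 2) (B (n ⊖ 4) (r ⊖ 3))) (B (n ⊖ 5) (r ⊖ 4))))
count r n 3 2 = ℤ._+_ (ℤ._+_ (ℤ._+_ (ℤ._+_
                  (ℤ._*_ (+ 2) (B (n ⊖ 4) (r ⊖ 4)))
                  (ℤ._-_ (ℤ._*_ (+ 3) (B (n ⊖ 4) (r ⊖ 3))) (B (n ⊖ 5) (r ⊖ 5))))
                  (ℤ._*_ (+ 3) (B (n ⊖ 6) (r ⊖ 4))))
                  (ℤ._*_ (+ 3) (B (n ⊖ 5) (r ⊖ 3))))
                  0ℤ
count r n 2 3 = ℤ._-_ (ℤ._+_ (ℤ._+_ (B (n ⊖ 2) (r ⊖ 2)) (B (n ⊖ 3) (r ⊖ 2)))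
                  (ℤ._*_ (+ 2) (B (n ⊖ 4) (r ⊖ 3))))
                  (B (n ⊖ 5) (r ⊖ 4))
count r n 3 3 = ℤ._+_ (ℤ._+_ (ℤ._+_ (B (n ⊖ 3) (r ⊖ 3))
                  (ℤ._*_ (+ 3) (B (n ⊖ 4) (r ⊖ 3))))
                  (ℤ._*_ (+ 5) (B (n ⊖ 5) (r ⊖ 3))))
                  (B (n ⊖ 6) (r ⊖ 4))
count r n s t = general r n s t

-- Sort A ∈ 𝒜_{n,r,s} by its s-th smallest element x. Since [s, 2s−1] is an interval, A ≺ [s, 2s−1]
-- only says x ≤ 2s−1: the s−1 smaller elements are then automatically small enough. Hence
--   |𝒜(X)| = Σ_{x=s}^{2s−1} C(x−1, s−1) C(n−x, r−s) − [x ∉ X] C(|[1,x) ∖ X|, s−1) C(|(x,n] ∖ X|, r−s),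
-- the subtracted term counting the sets that avoid X. For the sets X of the statement both sizes are
-- explicit, and unless s, t ∈ {2, 3} every pivot outside X lies above all elements of X below r+2.
-- Then Pascal's rule turns the summand at x into the x-th summands of the first two sums (x ≤ r+1),
-- the first term of E (x = r+2), or the x-th summand of the sum in E (x > r+2). In the four remaining
-- cases the sum has two or three terms and is evaluated by hand.

module Submission where

open import Defs
open import Function using (_∘_)
open import Data.Bool using (Bool; true; false; if_then_else_; _∧_; _∨_; not)
open import Data.Bool.Properties using (∧-identityʳ; ∧-zeroʳ; ∧-assoc; ∨-assoc; ∨-zeroʳ; ∨-identityʳ)
open import Data.Unit using (tt)
open import Data.Product using (_×_; _,_; map₁)
open import Data.Sum as Sum using (_⊎_; inj₁; inj₂; [_,_]′)
open import Data.Nat using (ℕ; _⊓_; zero; suc; _≤_; _<_; z<s; _+_; _*_; _∸_; _≤?_; _<?_; _≟_; z≤n; s≤s)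
open import Data.Nat.Properties
open import Data.Nat.Combinatorics using (_C_; nCk+nC[k+1]≡[n+1]C[k+1]; k>n⇒nCk≡0)
open import Data.Nat.ListAction using (sum)
open import Data.Nat.ListAction.Properties using (sum-++)
open import Data.Nat.Tactic.RingSolver using () renaming (solve-∀ to ℕ-solve-∀)
open import Algebra.Properties.CommutativeSemigroup +-commutativeSemigroup using (interchange)
open import Data.Integer using (ℤ; +_; -[1+_]; 0ℤ; _⊖_) renaming (_+_ to _+ᶻ_; _*_ to _*ᶻ_; _-_ to _-ᶻ_)
import Data.Integer.Properties as ℤ
open import Data.Integer.Tactic.RingSolver using (solve-∀)
open import Data.List using (List; []; _∷_; map; _++_; filter; length; applyUpTo; foldr)
open import Data.List.Properties using (map-++; map-cong; map-cong-local; map-∘; length-++; length-map)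
open import Data.List.Relation.Unary.All as All using (All; []; _∷_)
import Data.List.Relation.Unary.All.Properties as All
open import Data.List.Relation.Unary.Any using (any?)
open import Data.List.Membership.DecPropositional _≟_ using (_∈?_)
open import Relation.Nullary using (Dec; does; yes; no; contradiction)
open import Relation.Nullary.Decidable using (isYes≗does; dec-true; dec-false)
open import Relation.Binary.PropositionalEquality hiding ([_])
open ≡-Reasoning

cong₃ : ∀ {A B C D : Set} (f : A → B → C → D) {a a′ b b′ c c′} →
        a ≡ a′ → b ≡ b′ → c ≡ c′ → f a b c ≡ f a′ b′ c′
cong₃ f refl refl refl = refl

𝟙 : Bool → ℕ
𝟙 true = 1
𝟙 false = 0

countᵇ : {A : Set} → (A → Bool) → List A → ℕ
countᵇ p xs = sum (map (𝟙 ∘ p) xs)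

module _ {A : Set} where

  sum-map-++ : (f : A → ℕ) (xs ys : List A) →
               sum (map f (xs ++ ys)) ≡ sum (map f xs) + sum (map f ys)
  sum-map-++ f xs ys = trans (cong sum (map-++ f xs ys)) (sum-++ (map f xs) (map f ys))

  sum-map-∘ : {B : Set} (f : B → ℕ) (g : A → B) (xs : List A) →
              sum (map f (map g xs)) ≡ sum (map (f ∘ g) xs)
  sum-map-∘ f g xs = cong sum (sym (map-∘ xs))

  sum-map-+ : (f g : A → ℕ) (xs : List A) →
              sum (map (λ x → f x + g x) xs) ≡ sum (map f xs) + sum (map g xs)
  sum-map-+ f g [] = refl
  sum-map-+ f g (x ∷ xs) = trans (cong (_+_ (f x + g x)) (sum-map-+ f g xs))
                                 (interchange (f x) (g x) (sum (map f xs)) (sum (map g xs)))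

  sum-map-const : (c : ℕ) (xs : List A) → sum (map (λ _ → c) xs) ≡ length xs * c
  sum-map-const c [] = refl
  sum-map-const c (x ∷ xs) = cong (_+_ c) (sum-map-const c xs)

  sum-map-0 : (xs : List A) → sum (map (λ _ → 0) xs) ≡ 0
  sum-map-0 xs = trans (sum-map-const 0 xs) (*-zeroʳ (length xs))

  countᵇ-complement : (p : A → Bool) (xs : List A) →
                      countᵇ p xs + countᵇ (not ∘ p) xs ≡ length xs
  countᵇ-complement p xs = begin
    countᵇ p xs + countᵇ (not ∘ p) xs         ≡⟨ sum-map-+ (𝟙 ∘ p) (𝟙 ∘ not ∘ p) xs ⟨
    sum (map (λ x → 𝟙 (p x) + 𝟙 (not (p x))) xs) ≡⟨ cong sum (map-cong (λ x → 𝟙+𝟙-not (p x)) xs) ⟩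
    sum (map (λ _ → 1) xs)                     ≡⟨ sum-map-const 1 xs ⟩
    length xs * 1                              ≡⟨ *-identityʳ (length xs) ⟩
    length xs                                  ∎
    where
    𝟙+𝟙-not : ∀ b → 𝟙 b + 𝟙 (not b) ≡ 1
    𝟙+𝟙-not true = refl
    𝟙+𝟙-not false = refl

  length-filter-filter : {P Q : A → Set} (P? : ∀ x → Dec (P x)) (Q? : ∀ x → Dec (Q x)) (xs : List A) →
                         length (filter Q? (filter P? xs)) ≡ countᵇ (λ x → does (P? x) ∧ does (Q? x)) xs
  length-filter-filter P? Q? [] = refl
  length-filter-filter P? Q? (x ∷ xs) with does (P? x)
  ... | false = length-filter-filter P? Q? xs
  ... | true with does (Q? x)
  ...   | true = cong suc (length-filter-filter P? Q? xs)
  ...   | false = length-filter-filter P? Q? xs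

countᵇ-const-true : {A : Set} (xs : List A) → countᵇ (λ _ → true) xs ≡ length xs
countᵇ-const-true xs = trans (sum-map-const 1 xs) (*-identityʳ (length xs))

countᵇ-map : {A B : Set} (p : B → Bool) (f : A → B) (xs : List A) → countᵇ p (map f xs) ≡ countᵇ (p ∘ f) xs
countᵇ-map p f xs = sum-map-∘ (𝟙 ∘ p) f xs

countᵇ-pairs-∨-complement : {A B : Set} (p : A → Bool) (q : B → Bool) (xs : List A) (ys : List B) →
  sum (map (λ a → countᵇ (λ b → p a ∨ q b) ys) xs) + countᵇ (not ∘ p) xs * countᵇ (not ∘ q) ys
    ≡ length xs * length ys
countᵇ-pairs-∨-complement p q [] ys = refl
countᵇ-pairs-∨-complement p q (a ∷ xs) ys with p a
... | true = trans (+-assoc (countᵇ (λ _ → true) ys) _ _)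
                   (cong₂ _+_ (countᵇ-const-true ys) (countᵇ-pairs-∨-complement p q xs ys))
... | false = trans (interchange (countᵇ q ys) _ (countᵇ (not ∘ q) ys) _)
                    (cong₂ _+_ (countᵇ-complement q ys) (countᵇ-pairs-∨-complement p q xs ys))

range : ℕ → ℕ → List ℕ
range a zero = []
range a (suc m) = a ∷ range (suc a) m

interval≡range : ∀ a b → interval a b ≡ range a (suc b ∸ a)
interval≡range a b = go (λ i → i) a (suc b ∸ a) (λ i → refl)
  where
  go : ∀ (g : ℕ → ℕ) c m → (∀ i → a + g i ≡ c + i) → map (_+_ a) (applyUpTo g m) ≡ range c m
  go g c zero e = refl
  go g c (suc m) e = cong₂ _∷_ (trans (e 0) (+-identityʳ c))
                               (go (g ∘ suc) (suc c) m (λ i → trans (e (suc i)) (+-suc c i)))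

range-++ : ∀ a m₁ m₂ → range a (m₁ + m₂) ≡ range a m₁ ++ range (a + m₁) m₂
range-++ a zero m₂ = cong (λ b → range b m₂) (sym (+-identityʳ a))
range-++ a (suc m₁) m₂ = cong (a ∷_) (trans (range-++ (suc a) m₁ m₂)
                                            (cong (λ b → range (suc a) m₁ ++ range b m₂) (sym (+-suc a m₁))))

length-range : ∀ a m → length (range a m) ≡ m
length-range a zero = refl
length-range a (suc m) = cong suc (length-range (suc a) m)

∈?-++ : ∀ y xs ys → does (y ∈? (xs ++ ys)) ≡ does (y ∈? xs) ∨ does (y ∈? ys)
∈?-++ y [] ys = refl
∈?-++ y (x ∷ xs) ys = trans (cong (does (y ≟ x) ∨_) (∈?-++ y xs ys)) (sym (∨-assoc (does (y ≟ x)) _ _))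

∈?-range : ∀ y a m → a ≤ y → y < a + m → does (y ∈? range a m) ≡ true
∈?-range y a zero a≤y y<a+0 = contradiction (subst (y <_) (+-identityʳ a) y<a+0) (≤⇒≯ a≤y)
∈?-range y a (suc m) a≤y y<a+m with y ≟ a
... | yes y≡a = cong (_∨ does (y ∈? range (suc a) m)) (dec-true (y ≟ a) y≡a)
... | no y≢a = trans (cong (_∨ does (y ∈? range (suc a) m)) (dec-false (y ≟ a) y≢a))
                     (∈?-range y (suc a) m (≤∧≢⇒< a≤y (y≢a ∘ sym)) (subst (y <_) (+-suc a m) y<a+m))

∉?-range : ∀ y a m → y < a ⊎ a + m ≤ y → does (y ∈? range a m) ≡ false
∉?-range y a zero _ = refl
∉?-range y a (suc m) y∉ with y ≟ a
... | yes refl = contradiction y∉ [ <-irrefl refl , (λ y+m<y → <-irrefl refl (<-≤-trans (m<m+n y z<s) y+m<y)) ]′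
... | no y≢a = trans (cong (_∨ does (y ∈? range (suc a) m)) (dec-false (y ≟ a) y≢a))
                   (∉?-range y (suc a) m (Sum.map m<n⇒m<1+n (subst (_≤ y) (+-suc a m)) y∉))

∈?-All : ∀ {P : ℕ → Set} y xs → All P xs → does (y ∈? xs) ≡ true → P y
∈?-All y (x ∷ xs) (px ∷ pxs) y∈xs with y ≟ x
... | yes refl = px
... | no y≢x = ∈?-All y xs pxs (trans (sym (cong (_∨ does (y ∈? xs)) (dec-false (y ≟ x) y≢x))) y∈xs)

All-range : ∀ {P : ℕ → Set} a m → (∀ x → a ≤ x → x < a + m → P x) → All P (range a m)
All-range a zero h = []
All-range a (suc m) h = h a ≤-refl (m<m+n a z<s)
  ∷ All-range (suc a) m (λ x a<x x<a+m → h x (<⇒≤ a<x) (subst (x <_) (sym (+-suc a m)) x<a+m))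

map-cong-range : ∀ {B : Set} {f g : ℕ → B} a m → (∀ x → a ≤ x → x < a + m → f x ≡ g x) →
                 map f (range a m) ≡ map g (range a m)
map-cong-range a m h = map-cong-local (All-range a m h)

sum-map-range-0 : ∀ (f : ℕ → ℕ) a m → (∀ x → a ≤ x → x < a + m → f x ≡ 0) → sum (map f (range a m)) ≡ 0
sum-map-range-0 f a m f≡0 = trans (cong sum (map-cong-range a m f≡0)) (sum-map-0 (range a m))

Σℤ : List ℤ → ℤ
Σℤ = foldr _+ᶻ_ 0ℤ

Σℤ-++ : ∀ xs ys → Σℤ (xs ++ ys) ≡ Σℤ xs +ᶻ Σℤ ys
Σℤ-++ [] ys = sym (ℤ.+-identityˡ (Σℤ ys))
Σℤ-++ (x ∷ xs) ys = trans (cong (x +ᶻ_) (Σℤ-++ xs ys)) (sym (ℤ.+-assoc x (Σℤ xs) (Σℤ ys)))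

Σℤ-map-++ : ∀ {A : Set} (f : A → ℤ) xs ys → Σℤ (map f (xs ++ ys)) ≡ Σℤ (map f xs) +ᶻ Σℤ (map f ys)
Σℤ-map-++ f xs ys = trans (cong Σℤ (map-++ f xs ys)) (Σℤ-++ (map f xs) (map f ys))

Σℤ-map-+ : ∀ {A : Set} (f g : A → ℤ) xs → Σℤ (map (λ x → f x +ᶻ g x) xs) ≡ Σℤ (map f xs) +ᶻ Σℤ (map g xs)
Σℤ-map-+ f g [] = refl
Σℤ-map-+ f g (x ∷ xs) = trans (cong (f x +ᶻ g x +ᶻ_) (Σℤ-map-+ f g xs))
                              (interchangeᶻ (f x) (g x) (Σℤ (map f xs)) (Σℤ (map g xs)))
  where
  interchangeᶻ : ∀ a b c d → (a +ᶻ b) +ᶻ (c +ᶻ d) ≡ (a +ᶻ c) +ᶻ (b +ᶻ d)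
  interchangeᶻ = solve-∀

+-sum-map : ∀ {A : Set} (f : A → ℕ) xs → + sum (map f xs) ≡ Σℤ (map (+_ ∘ f) xs)
+-sum-map f [] = refl
+-sum-map f (x ∷ xs) = trans (ℤ.pos-+ (f x) (sum (map f xs))) (cong (+ f x +ᶻ_) (+-sum-map f xs))

B-vanish : ∀ x t j → x < t + j → B (x ⊖ t) (+ j) ≡ 0ℤ
B-vanish x t j x<t+j with x <? t
... | yes x<t rewrite ℤ.⊖-< x<t with t ∸ x | m<n⇒0<n∸m x<t
...   | suc _ | _ = refl
B-vanish x t j x<t+j | no x≮t rewrite ℤ.⊖-≥ (≮⇒≥ x≮t) =
  cong +_ (k>n⇒nCk≡0 (subst (x ∸ t <_) (m+n∸m≡n t j) (∸-monoˡ-< x<t+j (≮⇒≥ x≮t))))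

B-⊖ : ∀ m t k → t ≤ m → B (m ⊖ t) (+ k) ≡ + ((m ∸ t) C k)
B-⊖ m t k t≤m rewrite ℤ.⊖-≥ t≤m = refl

B-pascal : ∀ m z → B (+ suc m) z ≡ B (+ m) z +ᶻ B (+ m) (z -ᶻ + 1)
B-pascal m (+ zero) = refl
B-pascal m (+ suc k) = trans (cong +_ (sym (nCk+nC[k+1]≡[n+1]C[k+1] m k)))
                             (trans (ℤ.pos-+ (m C k) (m C suc k)) (ℤ.+-comm (+ (m C k)) (+ (m C suc k))))
B-pascal m -[1+ k ] = refl

⊖-suc : ∀ k i → (k ⊖ i) -ᶻ + 1 ≡ k ⊖ suc i
⊖-suc k i = begin
  (k ⊖ i) -ᶻ + 1          ≡⟨ cong (_-ᶻ + 1) (ℤ.m-n≡m⊖n k i) ⟨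
  (+ k -ᶻ + i) -ᶻ + 1     ≡⟨ shift (+ k) (+ i) ⟩
  + k -ᶻ (+ 1 +ᶻ + i)    ≡⟨ ℤ.m-n≡m⊖n k (suc i) ⟩
  k ⊖ suc i              ∎
  where
  shift : ∀ a b → (a -ᶻ b) -ᶻ + 1 ≡ a -ᶻ (+ 1 +ᶻ b)
  shift = solve-∀

length-choose : ∀ (L : List ℕ) k → length (choose L k) ≡ length L C k
length-choose [] zero = refl
length-choose [] (suc k) = refl
length-choose (x ∷ L) zero = refl
length-choose (x ∷ L) (suc k) = begin
  length (map (x ∷_) (choose L k) ++ choose L (suc k))
    ≡⟨ length-++ (map (x ∷_) (choose L k)) ⟩
  length (map (x ∷_) (choose L k)) + length (choose L (suc k))
    ≡⟨ cong₂ _+_ (trans (length-map (x ∷_) (choose L k)) (length-choose L k)) (length-choose L (suc k)) ⟩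
  length L C k + length L C suc k
    ≡⟨ nCk+nC[k+1]≡[n+1]C[k+1] (length L) k ⟩
  suc (length L) C suc k ∎

choose-short : ∀ (L : List ℕ) k → length L < k → choose L k ≡ []
choose-short [] (suc k) _ = refl
choose-short (x ∷ L) (suc k) (s≤s |L|<k)
  rewrite choose-short L k |L|<k | choose-short L (suc k) (m<n⇒m<1+n |L|<k) = refl

pivots : {A : Set} → List A → List (List A × A × List A)
pivots [] = []
pivots (x ∷ L) = ([] , x , L) ∷ map (map₁ (x ∷_)) (pivots L)

countPivoted : (List ℕ → Bool) → ℕ → ℕ → List ℕ × ℕ × List ℕ → ℕ
countPivoted p j k (L₁ , x , L₂) = sum (map (λ P → countᵇ (λ Q → p (P ++ x ∷ Q)) (choose L₂ k)) (choose L₁ j))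

-- A (j+1+k)-subset of L is split at its (j+1)-st element.
countᵇ-choose≡sum-pivots : ∀ (p : List ℕ → Bool) j k L →
  countᵇ p (choose L (j + suc k)) ≡ sum (map (countPivoted p j k) (pivots L))
countᵇ-choose≡sum-pivots p zero k [] = refl
countᵇ-choose≡sum-pivots p (suc j) k [] = refl
countᵇ-choose≡sum-pivots p zero k (y ∷ L) = begin
  countᵇ p (map (y ∷_) (choose L k) ++ choose L (suc k))
    ≡⟨ sum-map-++ (𝟙 ∘ p) (map (y ∷_) (choose L k)) (choose L (suc k)) ⟩
  countᵇ p (map (y ∷_) (choose L k)) + countᵇ p (choose L (suc k))
    ≡⟨ cong₂ _+_ (trans (countᵇ-map p (y ∷_) (choose L k)) (sym (+-identityʳ _)))
                 (countᵇ-choose≡sum-pivots p zero k L) ⟩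
  countPivoted p zero k ([] , y , L) + sum (map (countPivoted p zero k) (pivots L))
    ≡⟨ cong (_+_ (countPivoted p zero k ([] , y , L)))
            (sym (sum-map-∘ (countPivoted p zero k) (map₁ (y ∷_)) (pivots L))) ⟩
  sum (map (countPivoted p zero k) (pivots (y ∷ L))) ∎
countᵇ-choose≡sum-pivots p (suc j) k (y ∷ L) = begin
  countᵇ p (map (y ∷_) (choose L (j + suc k)) ++ choose L (suc j + suc k))
    ≡⟨ sum-map-++ (𝟙 ∘ p) (map (y ∷_) (choose L (j + suc k))) (choose L (suc j + suc k)) ⟩
  countᵇ p (map (y ∷_) (choose L (j + suc k))) + countᵇ p (choose L (suc j + suc k))
    ≡⟨ cong₂ _+_ (trans (countᵇ-map p (y ∷_) (choose L (j + suc k))) (countᵇ-choose≡sum-pivots (p ∘ (y ∷_)) j k L))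
                 (countᵇ-choose≡sum-pivots p (suc j) k L) ⟩
  sum (map (countPivoted (p ∘ (y ∷_)) j k) (pivots L)) + sum (map (countPivoted p (suc j) k) (pivots L))
    ≡⟨ sum-map-+ (countPivoted (p ∘ (y ∷_)) j k) (countPivoted p (suc j) k) (pivots L) ⟨
  sum (map (λ t → countPivoted (p ∘ (y ∷_)) j k t + countPivoted p (suc j) k t) (pivots L))
    ≡⟨ cong sum (map-cong split-first (pivots L)) ⟩
  sum (map (countPivoted p (suc j) k ∘ map₁ (y ∷_)) (pivots L))
    ≡⟨ sum-map-∘ (countPivoted p (suc j) k) (map₁ (y ∷_)) (pivots L) ⟨
  sum (map (countPivoted p (suc j) k) (pivots (y ∷ L))) ∎
  where
  split-first : ∀ t → countPivoted (p ∘ (y ∷_)) j k t + countPivoted p (suc j) k t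
                      ≡ countPivoted p (suc j) k (map₁ (y ∷_) t)
  split-first (L₁ , x , L₂) = sym (trans (sum-map-++ _ (map (y ∷_) (choose L₁ j)) (choose L₁ (suc j)))
                                         (cong (_+ countPivoted p (suc j) k (L₁ , x , L₂)) (sum-map-∘ _ (y ∷_) (choose L₁ j))))

All-length-choose : ∀ (L : List ℕ) j → All (λ P → length P ≡ j) (choose L j)
All-length-choose L zero = refl ∷ []
All-length-choose [] (suc j) = []
All-length-choose (x ∷ L) (suc j) =
  All.++⁺ (All.map⁺ (All.map (cong suc) (All-length-choose L j))) (All-length-choose L (suc j))

countPivoted-cong : ∀ {p q : List ℕ → Bool} j k L₁ x L₂ →
  All (λ P → ∀ Q → p (P ++ x ∷ Q) ≡ q (P ++ x ∷ Q)) (choose L₁ j) →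
  countPivoted p j k (L₁ , x , L₂) ≡ countPivoted q j k (L₁ , x , L₂)
countPivoted-cong j k L₁ x L₂ p≗q =
  cong sum (map-cong-local (All.map (λ e → cong sum (map-cong (λ Q → cong 𝟙 (e Q)) (choose L₂ k))) p≗q))

countPivoted-false : ∀ j k t → countPivoted (λ _ → false) j k t ≡ 0
countPivoted-false j k (L₁ , x , L₂) =
  trans (cong sum (map-cong (λ _ → sum-map-0 (choose L₂ k)) (choose L₁ j))) (sum-map-0 (choose L₁ j))

pivots-range : ∀ a m → pivots (range a m) ≡ map (λ x → (range a (x ∸ a) , x , range (suc x) (a + m ∸ suc x))) (range a m)
pivots-range a zero = refl
pivots-range a (suc m) = cong₂ _∷_ head (begin
  map (map₁ (a ∷_)) (pivots (range (suc a) m))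
    ≡⟨ cong (map (map₁ (a ∷_))) (pivots-range (suc a) m) ⟩
  map (map₁ (a ∷_)) (map _ (range (suc a) m))
    ≡⟨ map-∘ (range (suc a) m) ⟨
  map _ (range (suc a) m)
    ≡⟨ map-cong-range (suc a) m tail ⟩
  map _ (range (suc a) m) ∎)
  where
  head : ([] , a , range (suc a) m) ≡ (range a (a ∸ a) , a , range (suc a) (a + suc m ∸ suc a))
  head = cong₂ (λ l₁ l₂ → (l₁ , a , l₂)) (cong (range a) (sym (n∸n≡0 a)))
                (cong (range (suc a)) (sym (trans (cong (_∸ suc a) (+-suc a m)) (m+n∸m≡n a m))))
  tail : ∀ x → suc a ≤ x → x < suc a + m →
         (a ∷ range (suc a) (x ∸ suc a) , x , range (suc x) (suc a + m ∸ suc x))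
         ≡ (range a (x ∸ a) , x , range (suc x) (a + suc m ∸ suc x))
  tail x a<x _ = cong₂ (λ l₁ l₂ → (l₁ , x , l₂)) (cong (range a) (sym (+-∸-assoc 1 a<x)))
                      (cong (λ b → range (suc x) (b ∸ suc x)) (sym (+-suc a m)))

≺?[] : ∀ Q → does (Q ≺? []) ≡ true
≺?[] [] = refl
≺?[] (_ ∷ _) = refl

≺?-++ : ∀ P G x h Q → length P ≡ length G →
        does ((P ++ x ∷ Q) ≺? (G ++ h ∷ [])) ≡ does (P ≺? G) ∧ does (x ≤? h)
≺?-++ [] [] x h Q _ = trans (cong (does (x ≤? h) ∧_) (≺?[] Q)) (∧-identityʳ _)
≺?-++ (p ∷ P) (g ∷ G) x h Q |P|≡|G| =
  trans (cong (does (p ≤? g) ∧_) (≺?-++ P G x h Q (suc-injective |P|≡|G|))) (sym (∧-assoc (does (p ≤? g)) (does (P ≺? G)) (does (x ≤? h))))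

choose-range-≺ : ∀ a m g j → a + m ≤ g + j → All (_≺ range g j) (choose (range a m) j)
choose-range-≺ a m g zero _ = tt ∷ []
choose-range-≺ a zero g (suc j) _ = []
choose-range-≺ a (suc m) g (suc j) a+m≤g+j =
  All.++⁺ (All.map⁺ with-a) (choose-range-≺ (suc a) m g (suc j) (subst (_≤ g + suc j) (+-suc a m) a+m≤g+j))
  where
  with-a : All (λ P → (a ∷ P) ≺ range g (suc j)) (choose (range (suc a) m) j)
  with-a with j ≤? m
  ... | no j≰m rewrite choose-short (range (suc a) m) j (subst (_< j) (sym (length-range (suc a) m)) (≰⇒> j≰m)) = []
  ... | yes j≤m = All.map (a≤g ,_) (choose-range-≺ (suc a) m (suc g) j (subst₂ _≤_ (+-suc a m) (+-suc g j) a+m≤g+j))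
    where
    a≤g : a ≤ g
    a≤g = +-cancelʳ-≤ (suc m) a g (≤-trans a+m≤g+j (+-monoʳ-≤ g (s≤s j≤m)))

module Meeting (X : List ℕ) where

  inX : ℕ → Bool
  inX y = does (y ∈? X)

  meetsX : List ℕ → Bool
  meetsX A = does (any? (_∈? X) A)

  outside : List ℕ → ℕ
  outside = countᵇ (not ∘ inX)

  meetsX-++ : ∀ P x Q → meetsX (P ++ x ∷ Q) ≡ meetsX P ∨ (inX x ∨ meetsX Q)
  meetsX-++ [] x Q = refl
  meetsX-++ (p ∷ P) x Q = trans (cong (inX p ∨_) (meetsX-++ P x Q)) (sym (∨-assoc (inX p) (meetsX P) _))

  countᵇ-avoiding-choose : ∀ L k → countᵇ (not ∘ meetsX) (choose L k) ≡ outside L C k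
  countᵇ-avoiding-choose [] zero = refl
  countᵇ-avoiding-choose [] (suc k) = refl
  countᵇ-avoiding-choose (y ∷ L) zero = refl
  countᵇ-avoiding-choose (y ∷ L) (suc k) = begin
    countᵇ (not ∘ meetsX) (map (y ∷_) (choose L k) ++ choose L (suc k))
      ≡⟨ sum-map-++ (𝟙 ∘ not ∘ meetsX) (map (y ∷_) (choose L k)) (choose L (suc k)) ⟩
    countᵇ (not ∘ meetsX) (map (y ∷_) (choose L k)) + countᵇ (not ∘ meetsX) (choose L (suc k))
      ≡⟨ cong₂ _+_ (countᵇ-map (not ∘ meetsX) (y ∷_) (choose L k)) (countᵇ-avoiding-choose L (suc k)) ⟩
    countᵇ (λ Q → not (inX y ∨ meetsX Q)) (choose L k) + outside L C suc k
      ≡⟨ pascal (inX y) ⟩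
    outside (y ∷ L) C suc k ∎
    where
    pascal : ∀ b → countᵇ (λ Q → not (b ∨ meetsX Q)) (choose L k) + outside L C suc k
                   ≡ (𝟙 (not b) + outside L) C suc k
    pascal true = cong (_+ outside L C suc k) (sum-map-0 (choose L k))
    pascal false = trans (cong (_+ outside L C suc k) (countᵇ-avoiding-choose L k))
                         (nCk+nC[k+1]≡[n+1]C[k+1] (outside L) k)

  avoidingPairs : ℕ → ℕ → ℕ → List ℕ → List ℕ → ℕ
  avoidingPairs j k x L₁ L₂ = if inX x then 0 else (outside L₁ C j) * (outside L₂ C k)

  countPivoted-meetsX+avoidingPairs : ∀ j k x L₁ L₂ →
    countPivoted meetsX j k (L₁ , x , L₂) + avoidingPairs j k x L₁ L₂ ≡ (length L₁ C j) * (length L₂ C k)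
  countPivoted-meetsX+avoidingPairs j k x L₁ L₂ = begin
    countPivoted meetsX j k (L₁ , x , L₂) + avoidingPairs j k x L₁ L₂
      ≡⟨ cong (_+ avoidingPairs j k x L₁ L₂) (cong sum (map-cong (λ P → cong sum
           (map-cong (λ Q → cong 𝟙 (meetsX-++ P x Q)) Qs)) Ps)) ⟩
    sum (map (λ P → countᵇ (λ Q → meetsX P ∨ (inX x ∨ meetsX Q)) Qs) Ps) + avoidingPairs j k x L₁ L₂
      ≡⟨ by-pivot (inX x) ⟩
    length Ps * length Qs
      ≡⟨ cong₂ _*_ (length-choose L₁ j) (length-choose L₂ k) ⟩
    (length L₁ C j) * (length L₂ C k) ∎
    where
    Ps : List (List ℕ)
    Ps = choose L₁ j
    Qs : List (List ℕ)
    Qs = choose L₂ k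
    by-pivot : ∀ b → sum (map (λ P → countᵇ (λ Q → meetsX P ∨ (b ∨ meetsX Q)) Qs) Ps)
                     + (if b then 0 else (outside L₁ C j) * (outside L₂ C k)) ≡ length Ps * length Qs
    by-pivot true = begin
      sum (map (λ P → countᵇ (λ Q → meetsX P ∨ true) Qs) Ps) + 0
        ≡⟨ +-identityʳ _ ⟩
      sum (map (λ P → countᵇ (λ Q → meetsX P ∨ true) Qs) Ps)
        ≡⟨ cong sum (map-cong (λ P → trans (cong sum (map-cong (λ Q → cong 𝟙 (∨-zeroʳ (meetsX P))) Qs))
                                           (countᵇ-const-true Qs)) Ps) ⟩
      sum (map (λ _ → length Qs) Ps)
        ≡⟨ sum-map-const (length Qs) Ps ⟩
      length Ps * length Qs ∎
    by-pivot false = begin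
      sum (map (λ P → countᵇ (λ Q → meetsX P ∨ meetsX Q) Qs) Ps) + (outside L₁ C j) * (outside L₂ C k)
        ≡⟨ cong (_+_ (sum (map (λ P → countᵇ (λ Q → meetsX P ∨ meetsX Q) Qs) Ps)))
                (sym (cong₂ _*_ (countᵇ-avoiding-choose L₁ j) (countᵇ-avoiding-choose L₂ k))) ⟩
      sum (map (λ P → countᵇ (λ Q → meetsX P ∨ meetsX Q) Qs) Ps) + countᵇ (not ∘ meetsX) Ps * countᵇ (not ∘ meetsX) Qs
        ≡⟨ countᵇ-pairs-∨-complement meetsX meetsX Ps Qs ⟩
      length Ps * length Qs ∎

  outside-all : ∀ a m → (∀ y → a ≤ y → y < a + m → inX y ≡ false) → outside (range a m) ≡ m
  outside-all a m ∉X = trans (cong sum (map-cong-range a m (λ y a≤y y<a+m → cong (𝟙 ∘ not) (∉X y a≤y y<a+m))))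
                             (trans (sum-map-const 1 (range a m)) (trans (*-identityʳ _) (length-range a m)))

  outside-none : ∀ a m → (∀ y → a ≤ y → y < a + m → inX y ≡ true) → outside (range a m) ≡ 0
  outside-none a m ∈X = trans (cong sum (map-cong-range a m (λ y a≤y y<a+m → cong (𝟙 ∘ not) (∈X y a≤y y<a+m))))
                              (sum-map-0 (range a m))

  inX-beyond-bound : ∀ M → (∀ y → inX y ≡ true → y ≤ M) → ∀ y → M < y → inX y ≡ false
  inX-beyond-bound M bound y M<y with inX y | bound y
  ... | false | _ = refl
  ... | true | y≤M = contradiction (y≤M refl) (<⇒≱ M<y)

  outside-range-1-extend : ∀ M m → (∀ y → inX y ≡ true → y ≤ M) → M ≤ m →
    outside (range 1 m) ≡ outside (range 1 M) + (m ∸ M)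
  outside-range-1-extend M m bound M≤m = begin
    outside (range 1 m)                                 ≡⟨ cong (outside ∘ range 1) (m+[n∸m]≡n M≤m) ⟨
    outside (range 1 (M + (m ∸ M)))                     ≡⟨ cong outside (range-++ 1 M (m ∸ M)) ⟩
    outside (range 1 M ++ range (suc M) (m ∸ M))        ≡⟨ sum-map-++ (𝟙 ∘ not ∘ inX) (range 1 M) (range (suc M) (m ∸ M)) ⟩
    outside (range 1 M) + outside (range (suc M) (m ∸ M)) ≡⟨ cong (_+_ (outside (range 1 M))) (outside-all (suc M) (m ∸ M)
                                                             (λ y M<y _ → inX-beyond-bound M bound y M<y)) ⟩
    outside (range 1 M) + (m ∸ M)                       ∎

  pivotAt : ℕ → ℕ → List ℕ × ℕ × List ℕ
  pivotAt n x = (range 1 (x ∸ 1) , x , range (suc x) (n ∸ x))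

  -- The number of A ∈ 𝒜_{n,j+1+k,j+1}(X) with (j+1)-st element x: all choices of the other
  -- elements, minus those avoiding X.
  pivotTerm : ℕ → ℕ → ℕ → ℕ → ℤ
  pivotTerm j k n x = + ((x ∸ 1) C j) *ᶻ + ((n ∸ x) C k) -ᶻ
    (if inX x then 0ℤ else + (outside (range 1 (x ∸ 1)) C j) *ᶻ + (outside (range (suc x) (n ∸ x)) C k))

  +-countPivoted-meetsX : ∀ j k n x → + countPivoted meetsX j k (pivotAt n x) ≡ pivotTerm j k n x
  +-countPivoted-meetsX j k n x = begin
    + countPivoted meetsX j k (pivotAt n x)
      ≡⟨ +-cancel-avoiding (countPivoted-meetsX+avoidingPairs j k x L₁ L₂) ⟩
    + ((length L₁ C j) * (length L₂ C k)) -ᶻ + avoidingPairs j k x L₁ L₂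
      ≡⟨ cong₂ _-ᶻ_ (trans (ℤ.pos-* (length L₁ C j) (length L₂ C k))
                          (cong₂ (λ a b → + (a C j) *ᶻ + (b C k)) (length-range 1 (x ∸ 1)) (length-range (suc x) (n ∸ x))))
                    (+-avoidingPairs (inX x)) ⟩
    pivotTerm j k n x ∎
    where
    L₁ : List ℕ
    L₁ = range 1 (x ∸ 1)
    L₂ : List ℕ
    L₂ = range (suc x) (n ∸ x)
    +-cancel-avoiding : ∀ {m a t} → m + a ≡ t → + m ≡ + t -ᶻ + a
    +-cancel-avoiding {m} {a} refl = trans (sym (cancel (+ m) (+ a))) (cong (_-ᶻ + a) (sym (ℤ.pos-+ m a)))
      where
      cancel : ∀ u v → (u +ᶻ v) -ᶻ v ≡ u
      cancel = solve-∀
    +-avoidingPairs : ∀ b → + (if b then 0 else (outside L₁ C j) * (outside L₂ C k))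
                            ≡ (if b then 0ℤ else + (outside L₁ C j) *ᶻ + (outside L₂ C k))
    +-avoidingPairs true = refl
    +-avoidingPairs false = ℤ.pos-* (outside L₁ C j) (outside L₂ C k)

  module _ (j k n : ℕ) where

    -- A ≺ [s, 2s−1] and A meets X, with the last element of [s, 2s−1] split off.
    admissible : List ℕ → Bool
    admissible A = does (A ≺? (range (suc j) j ++ (suc j + j) ∷ [])) ∧ meetsX A

    private
      s : ℕ
      s = suc j
      h : ℕ
      h = s + j
      Gᵢ : List ℕ
      Gᵢ = range s j

      admissible-++ : ∀ P x Q → length P ≡ j →
        admissible (P ++ x ∷ Q) ≡ (does (P ≺? Gᵢ) ∧ does (x ≤? h)) ∧ meetsX (P ++ x ∷ Q)
      admissible-++ P x Q |P|≡j = cong (_∧ meetsX (P ++ x ∷ Q)) (≺?-++ P Gᵢ x h Q (trans |P|≡j (sym (length-range s j))))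

    countPivoted-below : ∀ x → 1 ≤ x → x < s → countPivoted admissible j k (pivotAt n x) ≡ 0
    countPivoted-below x 1≤x x<s =
      cong (λ Ps → sum (map (λ P → countᵇ (λ Q → admissible (P ++ x ∷ Q)) (choose (range (suc x) (n ∸ x)) k)) Ps))
           (choose-short (range 1 (x ∸ 1)) j (subst (_< j) (sym (length-range 1 (x ∸ 1))) (∸-monoˡ-< x<s 1≤x)))

    countPivoted-window : ∀ x → s ≤ x → x ≤ h →
      countPivoted admissible j k (pivotAt n x) ≡ countPivoted meetsX j k (pivotAt n x)
    countPivoted-window x s≤x x≤h =
      countPivoted-cong {admissible} {meetsX} j k (range 1 (x ∸ 1)) x (range (suc x) (n ∸ x))
        (All.zipWith agree (All-length-choose (range 1 (x ∸ 1)) j , choose-range-≺ 1 (x ∸ 1) s j fits))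
      where
      fits : 1 + (x ∸ 1) ≤ s + j
      fits = subst (_≤ s + j) (sym (m+[n∸m]≡n (≤-trans (s≤s z≤n) s≤x))) x≤h
      agree : ∀ {P} → length P ≡ j × P ≺ Gᵢ → ∀ Q → admissible (P ++ x ∷ Q) ≡ meetsX (P ++ x ∷ Q)
      agree {P} (|P|≡j , P≺Gᵢ) Q = trans (admissible-++ P x Q |P|≡j)
        (cong (λ b → b ∧ meetsX (P ++ x ∷ Q)) (cong₂ _∧_ (dec-true (P ≺? Gᵢ) P≺Gᵢ) (dec-true (x ≤? h) x≤h)))

    countPivoted-above : ∀ x → h < x → countPivoted admissible j k (pivotAt n x) ≡ 0
    countPivoted-above x h<x =
      trans (countPivoted-cong {admissible} {λ _ → false} j k (range 1 (x ∸ 1)) x (range (suc x) (n ∸ x))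
                               (All.map (λ {P} → reject {P}) (All-length-choose (range 1 (x ∸ 1)) j)))
            (countPivoted-false j k (pivotAt n x))
      where
      reject : ∀ {P} → length P ≡ j → ∀ Q → admissible (P ++ x ∷ Q) ≡ false
      reject {P} |P|≡j Q = trans (admissible-++ P x Q |P|≡j)
        (cong (_∧ meetsX (P ++ x ∷ Q)) (trans (cong (does (P ≺? Gᵢ) ∧_) (dec-false (x ≤? h) (<⇒≱ h<x))) (∧-zeroʳ _)))

  count-meets-𝒜 : ∀ j k n → j + suc j ≤ n →
    + length (meets (𝒜 n (suc j + k) (suc j)) X) ≡ Σℤ (map (pivotTerm j k n) (range (suc j) (suc j)))
  count-meets-𝒜 j k n 2s-1≤n = begin
    + length (meets (𝒜 n (suc j + k) s) X)
      ≡⟨ cong +_ (length-filter-filter (_≺? interval s (2 * s ∸ 1)) (any? (_∈? X)) (choose [ n ] (suc j + k))) ⟩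
    + countᵇ (λ A → does (A ≺? interval s (2 * s ∸ 1)) ∧ meetsX A) (choose [ n ] (suc j + k))
      ≡⟨ cong₃ (λ G L r → + countᵇ (λ A → does (A ≺? G) ∧ meetsX A) (choose L r))
               G≡ (interval≡range 1 n) (sym (+-suc j k)) ⟩
    + countᵇ (admissible j k n) (choose (range 1 n) (j + suc k))
      ≡⟨ cong +_ (countᵇ-choose≡sum-pivots (admissible j k n) j k (range 1 n)) ⟩
    + sum (map (countPivoted (admissible j k n) j k) (pivots (range 1 n)))
      ≡⟨ cong +_ (trans (cong (sum ∘ map (countPivoted (admissible j k n) j k)) (pivots-range 1 n))
                        (sum-map-∘ (countPivoted (admissible j k n) j k) (pivotAt n) (range 1 n))) ⟩
    + sum (map f (range 1 n))
      ≡⟨ cong (λ L → + sum (map f L)) split ⟩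
    + sum (map f (range 1 j ++ range s s ++ range (s + s) rest))
      ≡⟨ cong +_ (trans (sum-map-++ f (range 1 j) _) (cong (_+_ (sum (map f (range 1 j)))) (sum-map-++ f (range s s) _))) ⟩
    + (sum (map f (range 1 j)) + (sum (map f (range s s)) + sum (map f (range (s + s) rest))))
      ≡⟨ cong₃ (λ a b c → + (a + (b + c)))
               (sum-map-range-0 f 1 j (λ x 1≤x x<s → countPivoted-below j k n x 1≤x x<s))
               (cong sum (map-cong-range s s (λ x s≤x x<2s → countPivoted-window j k n x s≤x (≤-pred (subst (x <_) (+-suc s j) x<2s)))))
               (sum-map-range-0 f (s + s) rest (λ x 2s≤x _ → countPivoted-above j k n x (subst (_≤ x) (+-suc s j) 2s≤x))) ⟩
    + (sum (map (countPivoted meetsX j k ∘ pivotAt n) (range s s)) + 0)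
      ≡⟨ cong +_ (+-identityʳ _) ⟩
    + sum (map (countPivoted meetsX j k ∘ pivotAt n) (range s s))
      ≡⟨ +-sum-map (countPivoted meetsX j k ∘ pivotAt n) (range s s) ⟩
    Σℤ (map (+_ ∘ countPivoted meetsX j k ∘ pivotAt n) (range s s))
      ≡⟨ cong Σℤ (map-cong (+-countPivoted-meetsX j k n) (range s s)) ⟩
    Σℤ (map (pivotTerm j k n) (range s s)) ∎
    where
    s : ℕ
    s = suc j
    f : ℕ → ℕ
    f = countPivoted (admissible j k n) j k ∘ pivotAt n
    rest : ℕ
    rest = n ∸ (j + s)
    split : range 1 n ≡ range 1 j ++ range s s ++ range (s + s) rest
    split = trans (cong (range 1) (sym (trans (sym (+-assoc j s rest)) (m+[n∸m]≡n 2s-1≤n))))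
                  (trans (range-++ 1 j (s + rest)) (cong (range 1 j ++_) (range-++ s s rest)))
    G≡ : interval s (2 * s ∸ 1) ≡ range s j ++ (s + j) ∷ []
    G≡ = trans (interval≡range s (2 * s ∸ 1))
               (trans (cong (range s) (trans (cong (λ m → suc (s + m ∸ 1) ∸ s) (+-identityʳ s)) (m+n∸m≡n j s)))
                      (trans (cong (range s) (+-comm 1 j)) (range-++ s j 1)))

  outside-around : ∀ n x → 1 ≤ x → x ≤ n →
    outside (range 1 (x ∸ 1)) + (𝟙 (not (inX x)) + outside (range (suc x) (n ∸ x))) ≡ outside (range 1 n)
  outside-around n x 1≤x x≤n = sym (begin
    outside (range 1 n)
      ≡⟨ cong (outside ∘ range 1) (sym n≡) ⟩
    outside (range 1 ((x ∸ 1) + (1 + (n ∸ x))))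
      ≡⟨ cong outside (range-++ 1 (x ∸ 1) (1 + (n ∸ x))) ⟩
    outside (range 1 (x ∸ 1) ++ range (1 + (x ∸ 1)) (1 + (n ∸ x)))
      ≡⟨ cong (λ y → outside (range 1 (x ∸ 1) ++ range y (1 + (n ∸ x)))) (m+[n∸m]≡n 1≤x) ⟩
    outside (range 1 (x ∸ 1) ++ range x (1 + (n ∸ x)))
      ≡⟨ sum-map-++ (𝟙 ∘ not ∘ inX) (range 1 (x ∸ 1)) (range x (1 + (n ∸ x))) ⟩
    outside (range 1 (x ∸ 1)) + (𝟙 (not (inX x)) + outside (range (suc x) (n ∸ x))) ∎)
    where
    n≡ : (x ∸ 1) + (1 + (n ∸ x)) ≡ n
    n≡ = trans (sym (+-assoc (x ∸ 1) 1 (n ∸ x)))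
               (trans (cong (_+ (n ∸ x)) (trans (+-comm (x ∸ 1) 1) (m+[n∸m]≡n 1≤x))) (m+[n∸m]≡n x≤n))

  outside-above : ∀ n t x → outside (range 1 n) + t ≡ n → inX x ≡ false → 1 ≤ x → x ≤ n →
    outside (range (suc x) (n ∸ x)) ≡ n ∸ suc (outside (range 1 (x ∸ 1)) + t)
  outside-above n t x total x∉X 1≤x x≤n = sym (begin
    n ∸ suc (a + t)
      ≡⟨ cong (_∸ suc (a + t)) (sym total) ⟩
    outside (range 1 n) + t ∸ suc (a + t)
      ≡⟨ cong (λ m → m + t ∸ suc (a + t)) (sym (outside-around n x 1≤x x≤n)) ⟩
    a + (𝟙 (not (inX x)) + c) + t ∸ suc (a + t)
      ≡⟨ cong (λ b → a + (𝟙 (not b) + c) + t ∸ suc (a + t)) x∉X ⟩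
    a + suc c + t ∸ suc (a + t)
      ≡⟨ cong (_∸ suc (a + t)) (rearrange a c t) ⟩
    suc (a + t) + c ∸ suc (a + t)
      ≡⟨ m+n∸m≡n (suc (a + t)) c ⟩
    c ∎)
    where
    a : ℕ
    a = outside (range 1 (x ∸ 1))
    c : ℕ
    c = outside (range (suc x) (n ∸ x))
    rearrange : ∀ a c t → a + suc c + t ≡ suc (a + t) + c
    rearrange = ℕ-solve-∀

  outside-range-1-from-max : ∀ n t m → 1 ≤ m → m ≤ n → inX m ≡ true → (∀ y → m < y → inX y ≡ false) →
    outside (range 1 (m ∸ 1)) + t ≡ m → outside (range 1 n) + t ≡ n
  outside-range-1-from-max n t m 1≤m m≤n m∈X ∉X-beyond below = begin
    outside (range 1 n) + t
      ≡⟨ cong (_+ t) (outside-around n m 1≤m m≤n) ⟨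
    outside (range 1 (m ∸ 1)) + (𝟙 (not (inX m)) + outside (range (suc m) (n ∸ m))) + t
      ≡⟨ cong₂ (λ b c → outside (range 1 (m ∸ 1)) + (𝟙 (not b) + c) + t) m∈X
               (outside-all (suc m) (n ∸ m) (λ y m<y _ → ∉X-beyond y m<y)) ⟩
    outside (range 1 (m ∸ 1)) + (n ∸ m) + t
      ≡⟨ +-rearrange (outside (range 1 (m ∸ 1))) (n ∸ m) t ⟩
    outside (range 1 (m ∸ 1)) + t + (n ∸ m)
      ≡⟨ cong (_+ (n ∸ m)) below ⟩
    m + (n ∸ m)
      ≡⟨ m+[n∸m]≡n m≤n ⟩
    n ∎
    where
    +-rearrange : ∀ a b c → a + b + c ≡ a + c + b
    +-rearrange = ℕ-solve-∀

  outside-below-free-tail : ∀ n t x → outside (range 1 n) + t ≡ n → inX x ≡ false →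
    (∀ y → x < y → inX y ≡ false) → 1 ≤ x → x ≤ n → suc (outside (range 1 (x ∸ 1)) + t) ≡ x
  outside-below-free-tail n t x total x∉X ∉X-above 1≤x x≤n = +-cancelʳ-≡ (n ∸ x) _ x (begin
    suc (a + t) + (n ∸ x)
      ≡⟨ +-rearrange a t (n ∸ x) ⟩
    a + (1 + (n ∸ x)) + t
      ≡⟨ cong (λ c → a + (1 + c) + t) (sym (outside-all (suc x) (n ∸ x) (λ y x<y _ → ∉X-above y x<y))) ⟩
    a + (1 + outside (range (suc x) (n ∸ x))) + t
      ≡⟨ cong (λ b → a + (𝟙 (not b) + outside (range (suc x) (n ∸ x))) + t) x∉X ⟨
    a + (𝟙 (not (inX x)) + outside (range (suc x) (n ∸ x))) + t
      ≡⟨ cong (_+ t) (outside-around n x 1≤x x≤n) ⟩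
    outside (range 1 n) + t
      ≡⟨ total ⟩
    n
      ≡⟨ m+[n∸m]≡n x≤n ⟨
    x + (n ∸ x) ∎)
    where
    a : ℕ
    a = outside (range 1 (x ∸ 1))
    +-rearrange : ∀ a t c → suc (a + t) + c ≡ a + (1 + c) + t
    +-rearrange = ℕ-solve-∀

  pivotTerm-∈ : ∀ j k n x → inX x ≡ true → pivotTerm j k n x ≡ + ((x ∸ 1) C j) *ᶻ + ((n ∸ x) C k) -ᶻ 0ℤ
  pivotTerm-∈ j k n x x∈X rewrite x∈X = refl

  pivotTerm-∉ : ∀ j k n t x → outside (range 1 n) + t ≡ n → inX x ≡ false → 1 ≤ x → x ≤ n →
    pivotTerm j k n x ≡ + ((x ∸ 1) C j) *ᶻ + ((n ∸ x) C k)
                        -ᶻ + (outside (range 1 (x ∸ 1)) C j) *ᶻ + ((n ∸ suc (outside (range 1 (x ∸ 1)) + t)) C k)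
  pivotTerm-∉ j k n t x total x∉X 1≤x x≤n rewrite x∉X | outside-above n t x total x∉X 1≤x x≤n = refl

module GeneralFormula (X : List ℕ) (j k n t : ℕ) where
  open Meeting X

  s : ℕ
  s = suc j
  r : ℕ
  r = s + k

  diffTerm : ℕ → ℤ
  diffTerm i = (B (i ⊖ 1) (s ⊖ 1) -ᶻ B (i ⊖ t) (s ⊖ 1)) *ᶻ B (n ⊖ i) (r ⊖ s)

  lowCorrection : ℕ → ℤ
  lowCorrection i = B (i ⊖ t) (s ⊖ 1) *ᶻ B (n ⊖ suc i) (r ⊖ suc s)

  highCorrection : ℕ → ℤ
  highCorrection i = B (i ⊖ suc t) (s ⊖ 2) *ᶻ B (n ⊖ i) (r ⊖ s)

  topCorrection : ℤ
  topCorrection = B ((r + 2) ⊖ t) (s ⊖ 1) *ᶻ B (n ⊖ (r + 2)) (r ⊖ s)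

  h : ℕ
  h = 2 * s ∸ 1

  h≡s+j : h ≡ s + j
  h≡s+j = trans (cong (_+_ j) (+-identityʳ (suc j))) (+-suc j j)

  beyondTerm : Bool → ℤ
  beyondTerm b = if b then topCorrection +ᶻ Σℤ (map highCorrection (interval (r + 3) h)) else 0ℤ

  interval-s-h : interval s h ≡ range s s
  interval-s-h = trans (interval≡range s h)
                       (cong (range s) (trans (cong (λ m → suc m ∸ s) h≡s+j) (trans (cong (_∸ s) (sym (+-suc s j))) (m+n∸m≡n s s))))

  -- X has largest element r+2 and t−1 further elements; a pivot in X is too small to contribute,
  -- and a pivot outside X lies above every other element of X.
  record Regular : Set where
    field
      r+2≤n : r + 2 ≤ n
      r+2∈X : inX (r + 2) ≡ true
      ∉X-beyond : ∀ y → r + 2 < y → inX y ≡ false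
      outside-≤r+1 : outside (range 1 (suc r)) + t ≡ r + 2
      ∈X-small : ∀ x → s ≤ x → x ≤ suc r → inX x ≡ true → x < t + j
      ∉X-above : ∀ x → s ≤ x → x ≤ suc r → inX x ≡ false → outside (range 1 (x ∸ 1)) + t ≡ x

  r⊖s : r ⊖ s ≡ + k
  r⊖s = trans (cong (r ⊖_) (sym (+-identityʳ s))) (ℤ.+-cancelˡ-⊖ s k 0)

  r⊖s+1 : r ⊖ suc s ≡ k ⊖ 1
  r⊖s+1 = trans (cong (r ⊖_) (+-comm 1 s)) (ℤ.+-cancelˡ-⊖ s k 1)

  lowForm : ℕ → ℤ → ℤ
  lowForm x b = (+ ((x ∸ 1) C j) -ᶻ b) *ᶻ (+ (m C k) +ᶻ B (+ m) (k ⊖ 1)) +ᶻ b *ᶻ B (+ m) (k ⊖ 1)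
    where m = n ∸ suc x

  +C[n∸x] : ∀ x → x < n → + ((n ∸ x) C k) ≡ + ((n ∸ suc x) C k) +ᶻ B (+ (n ∸ suc x)) (k ⊖ 1)
  +C[n∸x] x x<n = trans (cong (λ l → + (l C k)) (+-∸-assoc 1 x<n)) (B-pascal (n ∸ suc x) (+ k))

  diff+low≡lowForm : ∀ x → 1 ≤ x → x < n → diffTerm x +ᶻ lowCorrection x ≡ lowForm x (B (x ⊖ t) (+ j))
  diff+low≡lowForm x 1≤x x<n rewrite ℤ.⊖-≥ 1≤x | ℤ.⊖-≥ (<⇒≤ x<n) | ℤ.⊖-≥ x<n | r⊖s | r⊖s+1 =
    cong (λ c → (+ ((x ∸ 1) C j) -ᶻ B (x ⊖ t) (+ j)) *ᶻ c +ᶻ B (x ⊖ t) (+ j) *ᶻ B (+ (n ∸ suc x)) (k ⊖ 1))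
         (+C[n∸x] x x<n)

  a₁ : ℕ
  a₁ = suc (suc k)

  s+a₁≡r+2 : s + a₁ ≡ r + 2
  s+a₁≡r+2 = trans (trans (+-suc s (suc k)) (cong suc (+-suc s k))) (+-comm 2 r)

  module _ (k+1<j : suc k < j) where

    long-split : range s s ≡ range s a₁ ++ (r + 2) ∷ range (r + 3) (j ∸ a₁)
    long-split = begin
      range s s                                       ≡⟨ cong (range s) (trans (cong suc (sym (m+[n∸m]≡n k+1<j))) (sym (+-suc a₁ (j ∸ a₁)))) ⟩
      range s (a₁ + suc (j ∸ a₁))                     ≡⟨ range-++ s a₁ (suc (j ∸ a₁)) ⟩
      range s a₁ ++ range (s + a₁) (suc (j ∸ a₁))     ≡⟨ cong (λ y → range s a₁ ++ y ∷ range (suc y) (j ∸ a₁)) s+a₁≡r+2 ⟩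
      range s a₁ ++ (r + 2) ∷ range (suc (r + 2)) (j ∸ a₁) ≡⟨ cong (λ y → range s a₁ ++ (r + 2) ∷ range y (j ∸ a₁)) (+-suc r 2) ⟨
      range s a₁ ++ (r + 2) ∷ range (r + 3) (j ∸ a₁)  ∎

    suc-h≡ : suc h ≡ r + 3 + (j ∸ a₁)
    suc-h≡ = trans (cong suc (trans h≡s+j (cong (_+_ s) (sym (m+[n∸m]≡n k+1<j))))) (rearrange s k (j ∸ a₁))
      where
      rearrange : ∀ s k d → suc (s + (suc (suc k) + d)) ≡ s + k + 3 + d
      rearrange = ℕ-solve-∀

    long-low : interval s (suc r ⊓ h) ≡ range s a₁
    long-low = trans (cong (interval s) (m≤n⇒m⊓n≡m r+1≤h))
                     (trans (interval≡range s (suc r)) (cong (range s) (trans (cong (_∸ s) r+2≡s+a₁) (m+n∸m≡n s a₁))))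
      where
      r+1≤h : suc r ≤ h
      r+1≤h = subst₂ _≤_ (+-suc s k) (sym h≡s+j) (+-monoʳ-≤ s (≤-trans (n≤1+n (suc k)) k+1<j))
      r+2≡s+a₁ : suc (suc r) ≡ s + a₁
      r+2≡s+a₁ = trans (+-comm 2 r) (sym s+a₁≡r+2)

    long-high : interval (r + 3) h ≡ range (r + 3) (j ∸ a₁)
    long-high = trans (interval≡range (r + 3) h) (cong (range (r + 3)) (trans (cong (_∸ (r + 3)) suc-h≡) (m+n∸m≡n (r + 3) (j ∸ a₁))))

    long-r+2≤h : r + 2 ≤ h
    long-r+2≤h = subst₂ _≤_ s+a₁≡r+2 (sym h≡s+j) (+-monoʳ-≤ s k+1<j)

  module _ (reg : Regular) where
    open Regular reg

    outside-≤n : outside (range 1 n) + t ≡ n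
    outside-≤n = outside-range-1-from-max n t (r + 2) (s≤s z≤n) r+2≤n r+2∈X ∉X-beyond
                   (subst (λ m → outside (range 1 (m ∸ 1)) + t ≡ r + 2) (+-comm 2 r) outside-≤r+1)

    pivotTerm-≤r+1 : ∀ x → s ≤ x → x ≤ suc r → pivotTerm j k n x ≡ diffTerm x +ᶻ lowCorrection x
    pivotTerm-≤r+1 x s≤x x≤r+1 = trans (by-membership (inX x) refl) (sym (diff+low≡lowForm x 1≤x x<n))
      where
      1≤x : 1 ≤ x
      1≤x = ≤-trans (s≤s z≤n) s≤x
      x<n : x < n
      x<n = ≤-trans (s≤s x≤r+1) (subst (_≤ n) (+-comm r 2) r+2≤n)
      A : ℤ
      A = + ((x ∸ 1) C j)
      c : ℤ
      c = + ((n ∸ suc x) C k)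
      D : ℤ
      D = B (+ (n ∸ suc x)) (k ⊖ 1)
      by-membership : ∀ b → inX x ≡ b → pivotTerm j k n x ≡ lowForm x (B (x ⊖ t) (+ j))
      by-membership true x∈X = begin
        pivotTerm j k n x                    ≡⟨ pivotTerm-∈ j k n x x∈X ⟩
        A *ᶻ + ((n ∸ x) C k) -ᶻ 0ℤ           ≡⟨ cong (λ N → A *ᶻ N -ᶻ 0ℤ) (+C[n∸x] x x<n) ⟩
        A *ᶻ (c +ᶻ D) -ᶻ 0ℤ                  ≡⟨ ring A c D ⟩
        lowForm x 0ℤ                         ≡⟨ cong (lowForm x) (B-vanish x t j (∈X-small x s≤x x≤r+1 x∈X)) ⟨
        lowForm x (B (x ⊖ t) (+ j))          ∎
        where
        ring : ∀ a c d → a *ᶻ (c +ᶻ d) -ᶻ 0ℤ ≡ (a -ᶻ 0ℤ) *ᶻ (c +ᶻ d) +ᶻ 0ℤ *ᶻ d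
        ring = solve-∀
      by-membership false x∉X = begin
        pivotTerm j k n x
          ≡⟨ pivotTerm-∉ j k n t x outside-≤n x∉X 1≤x (<⇒≤ x<n) ⟩
        A *ᶻ + ((n ∸ x) C k) -ᶻ + (a C j) *ᶻ + ((n ∸ suc (a + t)) C k)
          ≡⟨ cong₂ (λ N l → A *ᶻ N -ᶻ + (a C j) *ᶻ + ((n ∸ suc l) C k)) (+C[n∸x] x x<n) a+t≡x ⟩
        A *ᶻ (c +ᶻ D) -ᶻ + (a C j) *ᶻ c
          ≡⟨ ring A (+ (a C j)) c D ⟩
        lowForm x (+ (a C j))
          ≡⟨ cong (λ l → lowForm x (+ (l C j))) (trans (cong (_∸ t) (sym a+t≡x)) (m+n∸n≡m a t)) ⟨
        lowForm x (+ ((x ∸ t) C j))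
          ≡⟨ cong (lowForm x) (B-⊖ x t j t≤x) ⟨
        lowForm x (B (x ⊖ t) (+ j)) ∎
        where
        a : ℕ
        a = outside (range 1 (x ∸ 1))
        a+t≡x : a + t ≡ x
        a+t≡x = ∉X-above x s≤x x≤r+1 x∉X
        t≤x : t ≤ x
        t≤x = subst (t ≤_) a+t≡x (m≤n+m t a)
        ring : ∀ a b c d → a *ᶻ (c +ᶻ d) -ᶻ b *ᶻ c ≡ (a -ᶻ b) *ᶻ (c +ᶻ d) +ᶻ b *ᶻ d
        ring = solve-∀

    pivotTerm-r+2 : pivotTerm j k n (r + 2) ≡ diffTerm (r + 2) +ᶻ topCorrection
    pivotTerm-r+2 rewrite ℤ.⊖-≥ {r + 2} {1} (s≤s z≤n) | ℤ.⊖-≥ r+2≤n | r⊖s =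
      trans (pivotTerm-∈ j k n (r + 2) r+2∈X) (ring (+ ((r + 2 ∸ 1) C j)) (B ((r + 2) ⊖ t) (+ j)) (+ ((n ∸ (r + 2)) C k)))
      where
      ring : ∀ a b c → a *ᶻ c -ᶻ 0ℤ ≡ (a -ᶻ b) *ᶻ c +ᶻ b *ᶻ c
      ring = solve-∀

    pivotTerm->r+2 : ∀ x → r + 2 < x → x ≤ n → pivotTerm j k n x ≡ diffTerm x +ᶻ highCorrection x
    pivotTerm->r+2 x r+2<x x≤n = begin
      pivotTerm j k n x
        ≡⟨ pivotTerm-∉ j k n t x outside-≤n x∉X 1≤x x≤n ⟩
      A *ᶻ N -ᶻ + (a C j) *ᶻ + ((n ∸ suc (a + t)) C k)
        ≡⟨ cong₂ (λ l b → A *ᶻ N -ᶻ + (l C j) *ᶻ + ((n ∸ b) C k)) a≡m suc[a+t]≡x ⟩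
      A *ᶻ N -ᶻ + (m C j) *ᶻ N
        ≡⟨ ring A (+ (m C j)) N (B (+ m) (j ⊖ 1)) ⟩
      (A -ᶻ (+ (m C j) +ᶻ B (+ m) (j ⊖ 1))) *ᶻ N +ᶻ B (+ m) (j ⊖ 1) *ᶻ N
        ≡⟨ expand ⟨
      diffTerm x +ᶻ highCorrection x ∎
      where
      1≤x : 1 ≤ x
      1≤x = ≤-trans (s≤s z≤n) r+2<x
      x∉X : inX x ≡ false
      x∉X = ∉X-beyond x r+2<x
      A : ℤ
      A = + ((x ∸ 1) C j)
      N : ℤ
      N = + ((n ∸ x) C k)
      a : ℕ
      a = outside (range 1 (x ∸ 1))
      suc[a+t]≡x : suc (a + t) ≡ x
      suc[a+t]≡x = outside-below-free-tail n t x outside-≤n x∉X (λ y x<y → ∉X-beyond y (<-trans r+2<x x<y)) 1≤x x≤n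
      m : ℕ
      m = x ∸ suc t
      a≡m : a ≡ m
      a≡m = trans (sym (m+n∸m≡n (suc t) a)) (cong (_∸ suc t) (trans (cong suc (+-comm t a)) suc[a+t]≡x))
      t<x : t < x
      t<x = subst (suc t ≤_) suc[a+t]≡x (s≤s (m≤n+m t a))
      expand : diffTerm x +ᶻ highCorrection x ≡ (A -ᶻ (+ (m C j) +ᶻ B (+ m) (j ⊖ 1))) *ᶻ N +ᶻ B (+ m) (j ⊖ 1) *ᶻ N
      expand rewrite ℤ.⊖-≥ 1≤x | ℤ.⊖-≥ x≤n | r⊖s | ℤ.⊖-≥ (<⇒≤ t<x) | ℤ.⊖-≥ t<x | +-∸-assoc 1 t<x | ℤ.[1+m]⊖[1+n]≡m⊖n j 1 =
        cong (λ b → (A -ᶻ b) *ᶻ N +ᶻ B (+ m) (j ⊖ 1) *ᶻ N) (B-pascal m (+ j))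
      ring : ∀ a b c d → a *ᶻ c -ᶻ b *ᶻ c ≡ (a -ᶻ (b +ᶻ d)) *ᶻ c +ᶻ d *ᶻ c
      ring = solve-∀

    Σ-pivotTerm-short : j ≤ suc k → Σℤ (map (pivotTerm j k n) (range s s)) ≡ general r n s t
    Σ-pivotTerm-short j≤k+1 = begin
      Σℤ (map (pivotTerm j k n) (range s s))
        ≡⟨ cong Σℤ (map-cong-range s s (λ x s≤x x<2s → pivotTerm-≤r+1 x s≤x (x≤r+1 x x<2s))) ⟩
      Σℤ (map (λ x → diffTerm x +ᶻ lowCorrection x) (range s s))
        ≡⟨ Σℤ-map-+ diffTerm lowCorrection (range s s) ⟩
      Σℤ (map diffTerm (range s s)) +ᶻ Σℤ (map lowCorrection (range s s))
        ≡⟨ ℤ.+-identityʳ _ ⟨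
      Σℤ (map diffTerm (range s s)) +ᶻ Σℤ (map lowCorrection (range s s)) +ᶻ beyondTerm false
        ≡⟨ cong₃ (λ I J b → Σℤ (map diffTerm I) +ᶻ Σℤ (map lowCorrection J) +ᶻ beyondTerm b)
                 (sym interval-s-h) (sym (trans (cong (interval s) (m≥n⇒m⊓n≡n h≤r+1)) interval-s-h))
                 (sym (trans (isYes≗does (r + 2 ≤? h)) (dec-false (r + 2 ≤? h) (<⇒≱ (subst (h <_) (+-comm 2 r) (s≤s h≤r+1)))))) ⟩
      general r n s t ∎
      where
      h≤r+1 : h ≤ suc r
      h≤r+1 = subst₂ _≤_ (sym h≡s+j) (+-suc s k) (+-monoʳ-≤ s j≤k+1)
      x≤r+1 : ∀ x → x < s + s → x ≤ suc r
      x≤r+1 x x<2s = ≤-trans (≤-pred (subst (x <_) (+-suc s j) x<2s)) (subst (_≤ suc r) h≡s+j h≤r+1)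

    Σ-pivotTerm-long : suc k < j → h ≤ n → Σℤ (map (pivotTerm j k n) (range s s)) ≡ general r n s t
    Σ-pivotTerm-long k+1<j h≤n = begin
      Σℤ (map (pivotTerm j k n) (range s s))
        ≡⟨ cong (Σℤ ∘ map (pivotTerm j k n)) (long-split k+1<j) ⟩
      Σℤ (map (pivotTerm j k n) (low ++ (r + 2) ∷ high))
        ≡⟨ Σℤ-map-++ (pivotTerm j k n) low ((r + 2) ∷ high) ⟩
      Σℤ (map (pivotTerm j k n) low) +ᶻ (pivotTerm j k n (r + 2) +ᶻ Σℤ (map (pivotTerm j k n) high))
        ≡⟨ cong₂ _+ᶻ_ (trans (cong Σℤ (map-cong-range s a₁ at-low)) (Σℤ-map-+ diffTerm lowCorrection low))
                      (cong₂ _+ᶻ_ pivotTerm-r+2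
                             (trans (cong Σℤ (map-cong-range (r + 3) (j ∸ a₁) at-high)) (Σℤ-map-+ diffTerm highCorrection high))) ⟩
      (Σ diffTerm low +ᶻ Σ lowCorrection low)
        +ᶻ ((diffTerm (r + 2) +ᶻ topCorrection) +ᶻ (Σ diffTerm high +ᶻ Σ highCorrection high))
        ≡⟨ regroup (Σ diffTerm low) (Σ lowCorrection low) (diffTerm (r + 2)) topCorrection
                   (Σ diffTerm high) (Σ highCorrection high) ⟩
      (Σ diffTerm low +ᶻ (diffTerm (r + 2) +ᶻ Σ diffTerm high)) +ᶻ Σ lowCorrection low
        +ᶻ (topCorrection +ᶻ Σ highCorrection high)
        ≡⟨ cong (λ z → z +ᶻ Σ lowCorrection low +ᶻ (topCorrection +ᶻ Σ highCorrection high))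
                (Σℤ-map-++ diffTerm low ((r + 2) ∷ high)) ⟨
      Σ diffTerm (low ++ (r + 2) ∷ high) +ᶻ Σ lowCorrection low +ᶻ (topCorrection +ᶻ Σ highCorrection high)
        ≡⟨ cong₂ (λ I J → Σ diffTerm I +ᶻ Σ lowCorrection J +ᶻ (topCorrection +ᶻ Σ highCorrection high))
                 (sym (trans interval-s-h (long-split k+1<j))) (sym (long-low k+1<j)) ⟩
      Σ diffTerm (interval s h) +ᶻ Σ lowCorrection (interval s (suc r ⊓ h)) +ᶻ (topCorrection +ᶻ Σ highCorrection high)
        ≡⟨ cong (λ I → Σ diffTerm (interval s h) +ᶻ Σ lowCorrection (interval s (suc r ⊓ h)) +ᶻ (topCorrection +ᶻ Σ highCorrection I))
                (sym (long-high k+1<j)) ⟩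
      Σ diffTerm (interval s h) +ᶻ Σ lowCorrection (interval s (suc r ⊓ h)) +ᶻ beyondTerm true
        ≡⟨ cong (λ b → Σ diffTerm (interval s h) +ᶻ Σ lowCorrection (interval s (suc r ⊓ h)) +ᶻ beyondTerm b)
                (sym (trans (isYes≗does (r + 2 ≤? h)) (dec-true (r + 2 ≤? h) (long-r+2≤h k+1<j)))) ⟩
      general r n s t ∎
      where
      Σ : (ℕ → ℤ) → List ℕ → ℤ
      Σ f xs = Σℤ (map f xs)
      low : List ℕ
      low = range s a₁
      high : List ℕ
      high = range (r + 3) (j ∸ a₁)
      at-low : ∀ x → s ≤ x → x < s + a₁ → pivotTerm j k n x ≡ diffTerm x +ᶻ lowCorrection x
      at-low x s≤x x<s+a₁ = pivotTerm-≤r+1 x s≤x (≤-pred (subst (x <_) (trans s+a₁≡r+2 (+-comm r 2)) x<s+a₁))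
      at-high : ∀ x → r + 3 ≤ x → x < r + 3 + (j ∸ a₁) → pivotTerm j k n x ≡ diffTerm x +ᶻ highCorrection x
      at-high x r+3≤x x<h+1 = pivotTerm->r+2 x (subst (_≤ x) (+-suc r 2) r+3≤x)
        (≤-trans (≤-pred (subst (x <_) (sym (suc-h≡ k+1<j)) x<h+1)) h≤n)
      regroup : ∀ a b c e f g → (a +ᶻ b) +ᶻ ((c +ᶻ e) +ᶻ (f +ᶻ g)) ≡ (a +ᶻ (c +ᶻ f)) +ᶻ b +ᶻ (e +ᶻ g)
      regroup = solve-∀

    Σ-pivotTerm≡general : h ≤ n → Σℤ (map (pivotTerm j k n) (range s s)) ≡ general r n s t
    Σ-pivotTerm≡general h≤n with j ≤? suc k
    ... | yes j≤k+1 = Σ-pivotTerm-short j≤k+1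
    ... | no j≰k+1 = Σ-pivotTerm-long (≰⇒> j≰k+1) h≤n

module AdjoinTop (S : List ℕ) (j k n t : ℕ) where
  open GeneralFormula (S ++ (suc j + k + 2) ∷ []) j k n t using (s; r; Regular)
  open Meeting (S ++ (r + 2) ∷ [])
  private module S = Meeting S

  inX-≤r+1 : ∀ y → y ≤ suc r → inX y ≡ S.inX y
  inX-≤r+1 y y≤r+1 = trans (∈?-++ y S (r + 2 ∷ []))
    (trans (cong (λ b → S.inX y ∨ (b ∨ false)) (dec-false (y ≟ r + 2) y≢r+2)) (∨-identityʳ (S.inX y)))
    where
    y≢r+2 : y ≢ r + 2
    y≢r+2 refl = <⇒≱ (subst (suc r <_) (+-comm 2 r) ≤-refl) y≤r+1

  top∈X : inX (r + 2) ≡ true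
  top∈X = trans (∈?-++ (r + 2) S (r + 2 ∷ []))
    (trans (cong (λ b → S.inX (r + 2) ∨ (b ∨ false)) (dec-true (r + 2 ≟ r + 2) refl)) (∨-zeroʳ (S.inX (r + 2))))

  outside≡S-outside : ∀ m → m ≤ suc r → outside (range 1 m) ≡ S.outside (range 1 m)
  outside≡S-outside m m≤r+1 = cong sum (map-cong-range 1 m (λ y _ y<1+m →
    cong (𝟙 ∘ not) (inX-≤r+1 y (≤-trans (≤-pred y<1+m) m≤r+1))))

  pivotTerm-∈S : ∀ x → x ≤ suc r → S.inX x ≡ true → pivotTerm j k n x ≡ + ((x ∸ 1) C j) *ᶻ + ((n ∸ x) C k) -ᶻ 0ℤ
  pivotTerm-∈S x x≤r+1 x∈S = pivotTerm-∈ j k n x (trans (inX-≤r+1 x x≤r+1) x∈S)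

  module Bounded (M : ℕ) (M≤r+1 : M ≤ suc r) (S≤M : ∀ y → S.inX y ≡ true → y ≤ M)
                 (S-size : S.outside (range 1 M) + t ≡ suc M) where

    S-outside : ∀ m → M ≤ m → S.outside (range 1 m) + t ≡ suc m
    S-outside m M≤m = begin
      S.outside (range 1 m) + t            ≡⟨ cong (_+ t) (S.outside-range-1-extend M m S≤M M≤m) ⟩
      S.outside (range 1 M) + (m ∸ M) + t  ≡⟨ +-rearrange (S.outside (range 1 M)) (m ∸ M) t ⟩
      S.outside (range 1 M) + t + (m ∸ M)  ≡⟨ cong (_+ (m ∸ M)) S-size ⟩
      suc M + (m ∸ M)                      ≡⟨ cong suc (m+[n∸m]≡n M≤m) ⟩
      suc m                                ∎
      where
      +-rearrange : ∀ a b c → a + b + c ≡ a + c + b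
      +-rearrange = ℕ-solve-∀

    beyond-top : ∀ y → r + 2 < y → inX y ≡ false
    beyond-top y r+2<y = trans (∈?-++ y S (r + 2 ∷ []))
      (cong₂ (λ a b → a ∨ (b ∨ false))
             (S.inX-beyond-bound M S≤M y (≤-<-trans M≤r+1 (<-trans (subst (suc r <_) (+-comm 2 r) ≤-refl) r+2<y)))
             (dec-false (y ≟ r + 2) (λ y≡r+2 → <-irrefl (sym y≡r+2) r+2<y)))

    outside-below-top : outside (range 1 (suc r)) + t ≡ r + 2
    outside-below-top = trans (cong (_+ t) (outside≡S-outside (suc r) ≤-refl))
                              (trans (S-outside (suc r) M≤r+1) (+-comm 2 r))

    outside-≤n : r + 2 ≤ n → outside (range 1 n) + t ≡ n
    outside-≤n r+2≤n = outside-range-1-from-max n t (r + 2) (s≤s z≤n) r+2≤n top∈X beyond-top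
      (subst (λ m → outside (range 1 (m ∸ 1)) + t ≡ r + 2) (+-comm 2 r) outside-below-top)

    pivotTerm-∉S : r + 2 ≤ n → ∀ x → 1 ≤ x → x ≤ suc r → S.inX x ≡ false →
      pivotTerm j k n x ≡ + ((x ∸ 1) C j) *ᶻ + ((n ∸ x) C k)
                          -ᶻ + (S.outside (range 1 (x ∸ 1)) C j) *ᶻ + ((n ∸ suc (S.outside (range 1 (x ∸ 1)) + t)) C k)
    pivotTerm-∉S r+2≤n x 1≤x x≤r+1 x∉S =
      trans (pivotTerm-∉ j k n t x (outside-≤n r+2≤n) (trans (inX-≤r+1 x x≤r+1) x∉S) 1≤x
                         (≤-trans (≤-trans x≤r+1 (n≤1+n (suc r))) (subst (_≤ n) (+-comm r 2) r+2≤n)))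
            (cong (λ a → + ((x ∸ 1) C j) *ᶻ + ((n ∸ x) C k) -ᶻ + (a C j) *ᶻ + ((n ∸ suc (a + t)) C k))
                  (outside≡S-outside (x ∸ 1) (≤-trans (m∸n≤m x 1) x≤r+1)))

    regular : r + 2 ≤ n →
              (∀ x → s ≤ x → x ≤ suc r → S.inX x ≡ true → x < t + j) →
              (∀ x → s ≤ x → x ≤ suc r → S.inX x ≡ false → M < x) → Regular
    regular r+2≤n small large = record
      { r+2≤n = r+2≤n
      ; r+2∈X = top∈X
      ; ∉X-beyond = beyond-top
      ; outside-≤r+1 = outside-below-top
      ; ∈X-small = λ x s≤x x≤r+1 x∈X → small x s≤x x≤r+1 (trans (sym (inX-≤r+1 x x≤r+1)) x∈X)
      ; ∉X-above = above
      }
      where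
      above : ∀ x → s ≤ x → x ≤ suc r → inX x ≡ false → outside (range 1 (x ∸ 1)) + t ≡ x
      above x s≤x x≤r+1 x∉X = begin
        outside (range 1 (x ∸ 1)) + t    ≡⟨ cong (_+ t) (outside≡S-outside (x ∸ 1) (≤-trans (m∸n≤m x 1) x≤r+1)) ⟩
        S.outside (range 1 (x ∸ 1)) + t  ≡⟨ S-outside (x ∸ 1) (≤-pred (subst (M <_) (sym (m+[n∸m]≡n 1≤x)) M<x)) ⟩
        suc (x ∸ 1)                      ≡⟨ m+[n∸m]≡n 1≤x ⟩
        x                                ∎
        where
        1≤x : 1 ≤ x
        1≤x = ≤-trans (s≤s z≤n) s≤x
        M<x : M < x
        M<x = large x s≤x x≤r+1 (trans (sym (inX-≤r+1 x x≤r+1)) x∉X)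

count-meets-𝒜-regular : ∀ X j k n t → j + suc j ≤ n → GeneralFormula.Regular X j k n t →
  + length (meets (𝒜 n (suc j + k) (suc j)) X) ≡ general (suc j + k) n (suc j) t
count-meets-𝒜-regular X j k n t 2s-1≤n reg =
  trans (Meeting.count-meets-𝒜 X j k n 2s-1≤n)
        (GeneralFormula.Σ-pivotTerm≡general X j k n t reg (subst (_≤ n) (sym (trans (GeneralFormula.h≡s+j X j k n t) (sym (+-suc j j)))) 2s-1≤n))

regular-top : ∀ j k n → suc j + k + 2 ≤ n → GeneralFormula.Regular (suc j + k + 2 ∷ []) j k n 1
regular-top j k n r+2≤n =
  AdjoinTop.Bounded.regular [] j k n 1 0 z≤n (λ _ ()) refl r+2≤n (λ _ _ _ ()) (λ x s≤x _ _ → ≤-trans (s≤s z≤n) s≤x)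

regular-interval : ∀ j k n t → 1 ≤ j → 4 ≤ t → t ≤ suc (suc j + k) → suc j + k + 2 ≤ n →
                   GeneralFormula.Regular (interval 2 t ++ suc j + k + 2 ∷ []) j k n t
regular-interval j k n t 1≤j 4≤t t≤r+1 r+2≤n =
  AdjoinTop.Bounded.regular (interval 2 t) j k n t t t≤r+1 S≤t S-size r+2≤n small large
  where
  module S = Meeting (interval 2 t)
  1≤t : 1 ≤ t
  1≤t = ≤-trans (s≤s z≤n) 4≤t
  2+[t∸1] : 2 + (t ∸ 1) ≡ suc t
  2+[t∸1] = cong suc (m+[n∸m]≡n 1≤t)
  S≡ : interval 2 t ≡ range 2 (t ∸ 1)
  S≡ = interval≡range 2 t
  ∈S : ∀ y → 2 ≤ y → y ≤ t → S.inX y ≡ true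
  ∈S y 2≤y y≤t = trans (cong (does ∘ (y ∈?_)) S≡) (∈?-range y 2 (t ∸ 1) 2≤y (subst (y <_) (sym 2+[t∸1]) (s≤s y≤t)))
  S≤t : ∀ y → S.inX y ≡ true → y ≤ t
  S≤t y = ∈?-All y (interval 2 t) (subst (All (_≤ t)) (sym S≡)
            (All-range 2 (t ∸ 1) (λ y _ y<2+[t∸1] → ≤-pred (subst (y <_) 2+[t∸1] y<2+[t∸1]))))
  S-size : S.outside (range 1 t) + t ≡ suc t
  S-size = begin
    S.outside (range 1 t) + t                  ≡⟨ cong (λ m → S.outside (range 1 m) + t) (m+[n∸m]≡n 1≤t) ⟨
    S.outside (1 ∷ range 2 (t ∸ 1)) + t        ≡⟨ cong₂ (λ b o → 𝟙 (not b) + o + t)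
                                                        (trans (cong (does ∘ (1 ∈?_)) S≡) (∉?-range 1 2 (t ∸ 1) (inj₁ ≤-refl)))
                                                        (S.outside-none 2 (t ∸ 1) (λ y 2≤y y<2+[t∸1] →
                                                          ∈S y 2≤y (≤-pred (subst (y <_) 2+[t∸1] y<2+[t∸1])))) ⟩
    suc t                                      ∎
  small : ∀ x → suc j ≤ x → x ≤ suc (suc j + k) → S.inX x ≡ true → x < t + j
  small x _ _ x∈S = ≤-trans (s≤s (S≤t x x∈S)) (subst (_≤ t + j) (+-comm t 1) (+-monoʳ-≤ t 1≤j))
  large : ∀ x → suc j ≤ x → x ≤ suc (suc j + k) → S.inX x ≡ false → t < x
  large x s≤x _ x∉S with x ≤? t
  ... | no x≰t = ≰⇒> x≰t
  ... | yes x≤t = contradiction (trans (sym x∉S) (∈S x (≤-trans (s≤s 1≤j) s≤x) x≤t)) λ ()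

regular-≤4 : ∀ S j k n t → 3 ≤ j → 2 ≤ t → suc j + k + 2 ≤ n →
             (∀ y → does (y ∈? S) ≡ true → y ≤ 4) → does (4 ∈? S) ≡ true → Meeting.outside S (range 1 4) + t ≡ 5 →
             GeneralFormula.Regular (S ++ suc j + k + 2 ∷ []) j k n t
regular-≤4 S j k n t 3≤j 2≤t r+2≤n S≤4 4∈S S-size =
  AdjoinTop.Bounded.regular S j k n t 4 (≤-trans 4≤s (≤-trans (m≤m+n (suc j) k) (n≤1+n _))) S≤4 S-size r+2≤n small large
  where
  4≤s : 4 ≤ suc j
  4≤s = s≤s 3≤j
  small : ∀ x → suc j ≤ x → x ≤ suc (suc j + k) → does (x ∈? S) ≡ true → x < t + j
  small x _ _ x∈S = ≤-trans (s≤s (S≤4 x x∈S)) (+-mono-≤ 2≤t 3≤j)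
  large : ∀ x → suc j ≤ x → x ≤ suc (suc j + k) → does (x ∈? S) ≡ false → 4 < x
  large x s≤x _ x∉S with m≤n⇒m<n∨m≡n (≤-trans 4≤s s≤x)
  ... | inj₁ 4<x = 4<x
  ... | inj₂ refl = contradiction (trans (sym x∉S) 4∈S) λ ()

regular-4 : ∀ j k n → 3 ≤ j → suc j + k + 2 ≤ n → GeneralFormula.Regular (4 ∷ suc j + k + 2 ∷ []) j k n 2
regular-4 j k n 3≤j r+2≤n =
  regular-≤4 (4 ∷ []) j k n 2 3≤j ≤-refl r+2≤n (λ y → ∈?-All {_≤ 4} y (4 ∷ []) (≤-refl ∷ [])) refl refl

regular-2-4 : ∀ j k n → 3 ≤ j → suc j + k + 2 ≤ n → GeneralFormula.Regular (2 ∷ 4 ∷ suc j + k + 2 ∷ []) j k n 3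
regular-2-4 j k n 3≤j r+2≤n =
  regular-≤4 (2 ∷ 4 ∷ []) j k n 3 3≤j (s≤s (s≤s z≤n)) r+2≤n
             (λ y → ∈?-All {_≤ 4} y (2 ∷ 4 ∷ []) (s≤s (s≤s z≤n) ∷ ≤-refl ∷ [])) refl refl

module PascalExpansion (N k : ℕ) where

  a : ℕ → ℤ
  a i = B (+ N) (k ⊖ i)

  a¹ a² a³ : ℕ → ℤ
  a¹ i = a i +ᶻ a (suc i)
  a² i = a¹ i +ᶻ a¹ (suc i)
  a³ i = a² i +ᶻ a² (suc i)

  B-pascal-⊖ : ∀ m i → B (+ suc m) (k ⊖ i) ≡ B (+ m) (k ⊖ i) +ᶻ B (+ m) (k ⊖ suc i)
  B-pascal-⊖ m i = trans (B-pascal m (k ⊖ i)) (cong (λ z → B (+ m) (k ⊖ i) +ᶻ B (+ m) z) (⊖-suc k i))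

  B[N+1] : ∀ i → B (+ (1 + N)) (k ⊖ i) ≡ a¹ i
  B[N+1] i = B-pascal-⊖ N i

  B[N+2] : ∀ i → B (+ (2 + N)) (k ⊖ i) ≡ a² i
  B[N+2] i = trans (B-pascal-⊖ (1 + N) i) (cong₂ _+ᶻ_ (B[N+1] i) (B[N+1] (suc i)))

  B[N+3] : ∀ i → B (+ (3 + N)) (k ⊖ i) ≡ a³ i
  B[N+3] i = trans (B-pascal-⊖ (2 + N) i) (cong₂ _+ᶻ_ (B[N+2] i) (B[N+2] (suc i)))

-- For s, t ∈ {2, 3} the set X is not regular (2 or 3 is a pivot outside X lying below 4 ∈ X).
count-meets-𝒜-2-2 : ∀ k n → 1 ≤ k → 2 + k + 2 ≤ n →
  + length (meets (𝒜 n (2 + k) 2) (Xset (2 + k) 2)) ≡ count (2 + k) n 2 2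
count-meets-𝒜-2-2 k n 1≤k r+2≤n with m≤n⇒∃[o]m+o≡n (≤-trans (+-monoˡ-≤ 2 (s≤s (s≤s 1≤k))) r+2≤n)
... | N , refl =
  trans (count-meets-𝒜 1 k n (s≤s (s≤s (s≤s z≤n))))
        (trans (cong₂ (λ u v → u +ᶻ (v +ᶻ 0ℤ)) (pivotTerm-∉S r+2≤n 2 (s≤s z≤n) (s≤s (s≤s z≤n)) refl)
                                               (pivotTerm-∉S r+2≤n 3 (s≤s z≤n) (s≤s (s≤s (s≤s z≤n))) refl))
               (identity (B[N+3] 0) (B[N+1] 0) (B[N+2] 0) refl
                         (trans (cong (B (+ (2 + N))) (ℤ.+-cancelˡ-⊖ 2 k 1)) (B[N+2] 1))
                         (trans (cong (B (+ (1 + N))) (ℤ.+-cancelˡ-⊖ 2 k 2)) (B[N+1] 2))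
                         (trans (cong (B (+ (1 + N))) (ℤ.+-cancelˡ-⊖ 2 k 1)) (B[N+1] 1))
                         (cong (B (+ N)) (ℤ.+-cancelˡ-⊖ 2 k 2))))
  where
  open Meeting (Xset (2 + k) 2) using (count-meets-𝒜)
  open AdjoinTop (4 ∷ []) 1 k n 2
  open Bounded 4 (s≤s (s≤s (s≤s 1≤k))) (λ y → ∈?-All {_≤ 4} y (4 ∷ []) (≤-refl ∷ [])) refl
  open PascalExpansion N k
  identity : ∀ {X₃ X₁ X₂ X₀ Y₁ Y₂ Y₃ Y₄} →
    X₃ ≡ a³ 0 → X₁ ≡ a¹ 0 → X₂ ≡ a² 0 → X₀ ≡ a 0 → Y₁ ≡ a² 1 → Y₂ ≡ a¹ 2 → Y₃ ≡ a¹ 1 → Y₄ ≡ a 2 →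
    (+ 1 *ᶻ X₃ -ᶻ + 1 *ᶻ X₁) +ᶻ ((+ 2 *ᶻ X₂ -ᶻ + 2 *ᶻ X₀) +ᶻ 0ℤ) ≡ (+ 2 *ᶻ Y₁ -ᶻ Y₂) +ᶻ + 2 *ᶻ (+ 2 *ᶻ Y₃ -ᶻ Y₄)
  identity refl refl refl refl refl refl refl refl = ring (a 0) (a 1) (a 2) (a 3)
    where
    ring : ∀ a₀ a₁ a₂ a₃ →
      (+ 1 *ᶻ (((a₀ +ᶻ a₁) +ᶻ (a₁ +ᶻ a₂)) +ᶻ ((a₁ +ᶻ a₂) +ᶻ (a₂ +ᶻ a₃))) -ᶻ + 1 *ᶻ (a₀ +ᶻ a₁))
        +ᶻ ((+ 2 *ᶻ ((a₀ +ᶻ a₁) +ᶻ (a₁ +ᶻ a₂)) -ᶻ + 2 *ᶻ a₀) +ᶻ 0ℤ)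
      ≡ (+ 2 *ᶻ ((a₁ +ᶻ a₂) +ᶻ (a₂ +ᶻ a₃)) -ᶻ (a₂ +ᶻ a₃)) +ᶻ + 2 *ᶻ (+ 2 *ᶻ (a₁ +ᶻ a₂) -ᶻ a₂)
    ring = solve-∀

count-meets-𝒜-3-2 : ∀ k n → 1 ≤ k → 3 + k + 2 ≤ n →
  + length (meets (𝒜 n (3 + k) 3) (Xset (3 + k) 2)) ≡ count (3 + k) n 3 2
count-meets-𝒜-3-2 k n 1≤k r+2≤n with m≤n⇒∃[o]m+o≡n (≤-trans (+-monoˡ-≤ 2 (s≤s (s≤s (s≤s 1≤k)))) r+2≤n)
... | N , refl =
  trans (count-meets-𝒜 2 k n (s≤s (s≤s (s≤s (s≤s (s≤s z≤n))))))
        (trans (cong₃ (λ u v w → u +ᶻ (v +ᶻ (w +ᶻ 0ℤ)))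
                      (pivotTerm-∉S r+2≤n 3 (s≤s z≤n) (s≤s (s≤s (s≤s z≤n))) refl)
                      (pivotTerm-∈S 4 (s≤s (s≤s (s≤s (s≤s z≤n)))) refl)
                      (pivotTerm-∉S r+2≤n 5 (s≤s z≤n) (s≤s (s≤s (s≤s (s≤s 1≤k)))) refl))
               (identity (B[N+3] 0) (B[N+2] 0) (B[N+1] 0) refl
                         (trans (cong (B (+ (2 + N))) (ℤ.+-cancelˡ-⊖ 3 k 1)) (B[N+2] 1))
                         (trans (cong (B (+ (2 + N))) (ℤ.+-cancelˡ-⊖ 3 k 0)) (B[N+2] 0))
                         (trans (cong (B (+ (1 + N))) (ℤ.+-cancelˡ-⊖ 3 k 2)) (B[N+1] 2))
                         (cong (B (+ N)) (ℤ.+-cancelˡ-⊖ 3 k 1))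
                         (trans (cong (B (+ (1 + N))) (ℤ.+-cancelˡ-⊖ 3 k 0)) (B[N+1] 0))))
  where
  open Meeting (Xset (3 + k) 2) using (count-meets-𝒜)
  open AdjoinTop (4 ∷ []) 2 k n 2
  open Bounded 4 (s≤s (s≤s (s≤s (s≤s z≤n)))) (λ y → ∈?-All {_≤ 4} y (4 ∷ []) (≤-refl ∷ [])) refl
  open PascalExpansion N k
  identity : ∀ {X₃ X₂ X₁ X₀ Y₁ Y₂ Y₃ Y₄ Y₅} →
    X₃ ≡ a³ 0 → X₂ ≡ a² 0 → X₁ ≡ a¹ 0 → X₀ ≡ a 0 → Y₁ ≡ a² 1 → Y₂ ≡ a² 0 → Y₃ ≡ a¹ 2 → Y₄ ≡ a 1 → Y₅ ≡ a¹ 0 →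
    (+ 1 *ᶻ X₃ -ᶻ + 1 *ᶻ X₁) +ᶻ ((+ 3 *ᶻ X₂ -ᶻ 0ℤ) +ᶻ ((+ 6 *ᶻ X₁ -ᶻ + 3 *ᶻ X₀) +ᶻ 0ℤ))
      ≡ (((+ 2 *ᶻ Y₁ +ᶻ (+ 3 *ᶻ Y₂ -ᶻ Y₃)) +ᶻ + 3 *ᶻ Y₄) +ᶻ + 3 *ᶻ Y₅) +ᶻ 0ℤ
  identity refl refl refl refl refl refl refl refl refl = ring (a 0) (a 1) (a 2) (a 3)
    where
    ring : ∀ a₀ a₁ a₂ a₃ →
      (+ 1 *ᶻ (((a₀ +ᶻ a₁) +ᶻ (a₁ +ᶻ a₂)) +ᶻ ((a₁ +ᶻ a₂) +ᶻ (a₂ +ᶻ a₃))) -ᶻ + 1 *ᶻ (a₀ +ᶻ a₁))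
        +ᶻ ((+ 3 *ᶻ ((a₀ +ᶻ a₁) +ᶻ (a₁ +ᶻ a₂)) -ᶻ 0ℤ) +ᶻ ((+ 6 *ᶻ (a₀ +ᶻ a₁) -ᶻ + 3 *ᶻ a₀) +ᶻ 0ℤ))
      ≡ (((+ 2 *ᶻ ((a₁ +ᶻ a₂) +ᶻ (a₂ +ᶻ a₃)) +ᶻ (+ 3 *ᶻ ((a₀ +ᶻ a₁) +ᶻ (a₁ +ᶻ a₂)) -ᶻ (a₂ +ᶻ a₃)))
           +ᶻ + 3 *ᶻ a₁) +ᶻ + 3 *ᶻ (a₀ +ᶻ a₁)) +ᶻ 0ℤ
    ring = solve-∀

count-meets-𝒜-2-3 : ∀ k n → 1 ≤ k → 2 + k + 2 ≤ n →
  + length (meets (𝒜 n (2 + k) 2) (Xset (2 + k) 3)) ≡ count (2 + k) n 2 3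
count-meets-𝒜-2-3 k n 1≤k r+2≤n with m≤n⇒∃[o]m+o≡n (≤-trans (+-monoˡ-≤ 2 (s≤s (s≤s 1≤k))) r+2≤n)
... | N , refl =
  trans (count-meets-𝒜 1 k n (s≤s (s≤s (s≤s z≤n))))
        (trans (cong₂ (λ u v → u +ᶻ (v +ᶻ 0ℤ)) (pivotTerm-∈S 2 (s≤s (s≤s z≤n)) refl)
                                               (pivotTerm-∉S r+2≤n 3 (s≤s z≤n) (s≤s (s≤s (s≤s z≤n))) refl))
               (identity (B[N+3] 0) (B[N+2] 0) refl
                         (trans (cong (B (+ (3 + N))) (ℤ.+-cancelˡ-⊖ 2 k 0)) (B[N+3] 0))
                         (trans (cong (B (+ (2 + N))) (ℤ.+-cancelˡ-⊖ 2 k 0)) (B[N+2] 0))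
                         (trans (cong (B (+ (1 + N))) (ℤ.+-cancelˡ-⊖ 2 k 1)) (B[N+1] 1))
                         (cong (B (+ N)) (ℤ.+-cancelˡ-⊖ 2 k 2))))
  where
  open Meeting (Xset (2 + k) 3) using (count-meets-𝒜)
  open AdjoinTop (2 ∷ 4 ∷ []) 1 k n 3
  open Bounded 4 (s≤s (s≤s (s≤s 1≤k))) (λ y → ∈?-All {_≤ 4} y (2 ∷ 4 ∷ []) (s≤s (s≤s z≤n) ∷ ≤-refl ∷ [])) refl
  open PascalExpansion N k
  identity : ∀ {X₃ X₂ X₀ Y₁ Y₂ Y₃ Y₄} →
    X₃ ≡ a³ 0 → X₂ ≡ a² 0 → X₀ ≡ a 0 → Y₁ ≡ a³ 0 → Y₂ ≡ a² 0 → Y₃ ≡ a¹ 1 → Y₄ ≡ a 2 →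
    (+ 1 *ᶻ X₃ -ᶻ 0ℤ) +ᶻ ((+ 2 *ᶻ X₂ -ᶻ + 1 *ᶻ X₀) +ᶻ 0ℤ) ≡ ((Y₁ +ᶻ Y₂) +ᶻ + 2 *ᶻ Y₃) -ᶻ Y₄
  identity refl refl refl refl refl refl refl = ring (a 0) (a 1) (a 2) (a 3)
    where
    ring : ∀ a₀ a₁ a₂ a₃ →
      (+ 1 *ᶻ (((a₀ +ᶻ a₁) +ᶻ (a₁ +ᶻ a₂)) +ᶻ ((a₁ +ᶻ a₂) +ᶻ (a₂ +ᶻ a₃))) -ᶻ 0ℤ)
        +ᶻ ((+ 2 *ᶻ ((a₀ +ᶻ a₁) +ᶻ (a₁ +ᶻ a₂)) -ᶻ + 1 *ᶻ a₀) +ᶻ 0ℤ)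
      ≡ ((((a₀ +ᶻ a₁) +ᶻ (a₁ +ᶻ a₂)) +ᶻ ((a₁ +ᶻ a₂) +ᶻ (a₂ +ᶻ a₃))) +ᶻ ((a₀ +ᶻ a₁) +ᶻ (a₁ +ᶻ a₂))
           +ᶻ + 2 *ᶻ (a₁ +ᶻ a₂)) -ᶻ a₂
    ring = solve-∀

count-meets-𝒜-3-3 : ∀ k n → 1 ≤ k → 3 + k + 2 ≤ n →
  + length (meets (𝒜 n (3 + k) 3) (Xset (3 + k) 3)) ≡ count (3 + k) n 3 3
count-meets-𝒜-3-3 k n 1≤k r+2≤n with m≤n⇒∃[o]m+o≡n (≤-trans (+-monoˡ-≤ 2 (s≤s (s≤s (s≤s 1≤k)))) r+2≤n)
... | N , refl =
  trans (count-meets-𝒜 2 k n (s≤s (s≤s (s≤s (s≤s (s≤s z≤n))))))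
        (trans (cong₃ (λ u v w → u +ᶻ (v +ᶻ (w +ᶻ 0ℤ)))
                      (pivotTerm-∉S r+2≤n 3 (s≤s z≤n) (s≤s (s≤s (s≤s z≤n))) refl)
                      (pivotTerm-∈S 4 (s≤s (s≤s (s≤s (s≤s z≤n)))) refl)
                      (pivotTerm-∉S r+2≤n 5 (s≤s z≤n) (s≤s (s≤s (s≤s (s≤s 1≤k)))) refl))
               (identity (B[N+3] 0) (B[N+2] 0) (B[N+1] 0) refl
                         (trans (cong (B (+ (3 + N))) (ℤ.+-cancelˡ-⊖ 3 k 0)) (B[N+3] 0))
                         (trans (cong (B (+ (2 + N))) (ℤ.+-cancelˡ-⊖ 3 k 0)) (B[N+2] 0))
                         (trans (cong (B (+ (1 + N))) (ℤ.+-cancelˡ-⊖ 3 k 0)) (B[N+1] 0))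
                         (cong (B (+ N)) (ℤ.+-cancelˡ-⊖ 3 k 1))))
  where
  open Meeting (Xset (3 + k) 3) using (count-meets-𝒜)
  open AdjoinTop (2 ∷ 4 ∷ []) 2 k n 3
  open Bounded 4 (s≤s (s≤s (s≤s (s≤s z≤n)))) (λ y → ∈?-All {_≤ 4} y (2 ∷ 4 ∷ []) (s≤s (s≤s z≤n) ∷ ≤-refl ∷ [])) refl
  open PascalExpansion N k
  identity : ∀ {X₃ X₂ X₁ X₀ Y₁ Y₂ Y₃ Y₄} →
    X₃ ≡ a³ 0 → X₂ ≡ a² 0 → X₁ ≡ a¹ 0 → X₀ ≡ a 0 → Y₁ ≡ a³ 0 → Y₂ ≡ a² 0 → Y₃ ≡ a¹ 0 → Y₄ ≡ a 1 →
    (+ 1 *ᶻ X₃ -ᶻ + 0 *ᶻ X₁) +ᶻ ((+ 3 *ᶻ X₂ -ᶻ 0ℤ) +ᶻ ((+ 6 *ᶻ X₁ -ᶻ + 1 *ᶻ X₀) +ᶻ 0ℤ))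
      ≡ ((Y₁ +ᶻ + 3 *ᶻ Y₂) +ᶻ + 5 *ᶻ Y₃) +ᶻ Y₄
  identity refl refl refl refl refl refl refl refl = ring (a 0) (a 1) (a 2) (a 3)
    where
    ring : ∀ a₀ a₁ a₂ a₃ →
      (+ 1 *ᶻ (((a₀ +ᶻ a₁) +ᶻ (a₁ +ᶻ a₂)) +ᶻ ((a₁ +ᶻ a₂) +ᶻ (a₂ +ᶻ a₃))) -ᶻ + 0 *ᶻ (a₀ +ᶻ a₁))
        +ᶻ ((+ 3 *ᶻ ((a₀ +ᶻ a₁) +ᶻ (a₁ +ᶻ a₂)) -ᶻ 0ℤ) +ᶻ ((+ 6 *ᶻ (a₀ +ᶻ a₁) -ᶻ + 1 *ᶻ a₀) +ᶻ 0ℤ))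
      ≡ (((((a₀ +ᶻ a₁) +ᶻ (a₁ +ᶻ a₂)) +ᶻ ((a₁ +ᶻ a₂) +ᶻ (a₂ +ᶻ a₃))) +ᶻ + 3 *ᶻ ((a₀ +ᶻ a₁) +ᶻ (a₁ +ᶻ a₂)))
           +ᶻ + 5 *ᶻ (a₀ +ᶻ a₁)) +ᶻ a₁
    ring = solve-∀

count≡general : ∀ r n j t → t ≡ 1 ⊎ 4 ≤ t → count r n (suc j) t ≡ general r n (suc j) t
count≡general r n zero t _ = refl
count≡general r n (suc zero) .1 (inj₁ refl) = refl
count≡general r n (suc zero) _ (inj₂ (s≤s (s≤s (s≤s (s≤s _))))) = refl
count≡general r n (suc (suc zero)) .1 (inj₁ refl) = refl
count≡general r n (suc (suc zero)) _ (inj₂ (s≤s (s≤s (s≤s (s≤s _))))) = refl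
count≡general r n (suc (suc (suc j))) t _ = refl

r+2≤2r : ∀ r n → 2 ≤ r → 2 * r ≤ n → r + 2 ≤ n
r+2≤2r r n 2≤r 2r≤n = ≤-trans (+-monoʳ-≤ r (subst (2 ≤_) (sym (+-identityʳ r)) 2≤r)) 2r≤n

2s-1≤2r : ∀ j k n → 2 * (suc j + k) ≤ n → j + suc j ≤ n
2s-1≤2r j k n 2r≤n = ≤-trans (+-mono-≤ (≤-trans (n≤1+n j) (m≤m+n (suc j) k))
                                       (subst (suc j ≤_) (sym (+-identityʳ _)) (m≤m+n (suc j) k))) 2r≤n

count-meets-𝒜-Xset : ∀ j k n t → 1 ≤ j → 4 ≤ suc j + k → 2 * (suc j + k) ≤ n → ValidT (suc j + k) t →
  + length (meets (𝒜 n (suc j + k) (suc j)) (Xset (suc j + k) t)) ≡ count (suc j + k) n (suc j) t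
count-meets-𝒜-Xset j k n .1 1≤j 4≤r 2r≤n t1 =
  trans (count-meets-𝒜-regular _ j k n 1 (2s-1≤2r j k n 2r≤n) (regular-top j k n (r+2≤2r _ n (≤-trans (s≤s (s≤s z≤n)) 4≤r) 2r≤n)))
        (sym (count≡general _ n j 1 (inj₁ refl)))
count-meets-𝒜-Xset j k n t 1≤j 4≤r 2r≤n (t≥4 4≤t@(s≤s (s≤s (s≤s (s≤s _)))) t≤r+1) =
  trans (count-meets-𝒜-regular _ j k n t (2s-1≤2r j k n 2r≤n)
          (regular-interval j k n t 1≤j 4≤t t≤r+1 (r+2≤2r _ n (≤-trans (s≤s (s≤s z≤n)) 4≤r) 2r≤n)))
        (sym (count≡general _ n j t (inj₂ 4≤t)))
count-meets-𝒜-Xset j@(suc (suc (suc _))) k n .2 _ 4≤r 2r≤n t2 =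
  count-meets-𝒜-regular _ j k n 2 (2s-1≤2r j k n 2r≤n)
    (regular-4 j k n (s≤s (s≤s (s≤s z≤n))) (r+2≤2r _ n (≤-trans (s≤s (s≤s z≤n)) 4≤r) 2r≤n))
count-meets-𝒜-Xset j@(suc (suc (suc _))) k n .3 _ 4≤r 2r≤n t3 =
  count-meets-𝒜-regular _ j k n 3 (2s-1≤2r j k n 2r≤n)
    (regular-2-4 j k n (s≤s (s≤s (s≤s z≤n))) (r+2≤2r _ n (≤-trans (s≤s (s≤s z≤n)) 4≤r) 2r≤n))
count-meets-𝒜-Xset 1 k n .2 _ 4≤r 2r≤n t2 =
  count-meets-𝒜-2-2 k n (≤-trans (n≤1+n 1) (≤-pred (≤-pred 4≤r))) (r+2≤2r (2 + k) n (s≤s (s≤s z≤n)) 2r≤n)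
count-meets-𝒜-Xset 1 k n .3 _ 4≤r 2r≤n t3 =
  count-meets-𝒜-2-3 k n (≤-trans (n≤1+n 1) (≤-pred (≤-pred 4≤r))) (r+2≤2r (2 + k) n (s≤s (s≤s z≤n)) 2r≤n)
count-meets-𝒜-Xset 2 k n .2 _ 4≤r 2r≤n t2 =
  count-meets-𝒜-3-2 k n (≤-pred (≤-pred (≤-pred 4≤r))) (r+2≤2r (3 + k) n (s≤s (s≤s z≤n)) 2r≤n)
count-meets-𝒜-Xset 2 k n .3 _ 4≤r 2r≤n t3 =
  count-meets-𝒜-3-3 k n (≤-pred (≤-pred (≤-pred 4≤r))) (r+2≤2r (3 + k) n (s≤s (s≤s z≤n)) 2r≤n)

lemma12 : (r n s t : ℕ) → 4 ≤ r → 2 * r ≤ n → 2 ≤ s → s ≤ r → ValidT r t →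
          + length (meets (𝒜 n r s) (Xset r t)) ≡ count r n s t
lemma12 r n s t 4≤r 2r≤n 2≤s s≤r vt with m≤n⇒∃[o]m+o≡n 2≤s | m≤n⇒∃[o]m+o≡n s≤r
... | j , refl | k , refl = count-meets-𝒜-Xset (suc j) k n t (s≤s z≤n) 4≤r 2r≤n vt
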